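{- Let $(X,S)$ be a coherent configuration and let $(S,\dot\nabla,e)$ be its associated dagger Frobenius structure, where $\dot\nabla_{ab}^c=\sqrt{\frac{\|c\|}{\|a\|\|b\|}}\,\nabla_{ab}^c$. Let $\mathbf v\colon I\to S$ be the valency vector, $\mathbf v_*^a=\sqrt{\|a\|}$ for $a\in S$. Then $\mathbf v$ is an eigenvector of the matrix $\dot\nabla\circ\dot\nabla^\dagger\colon S\to S$ with eigenvalue $n=|X|$.
   Context: Matrices have non-negative real entries and are indexed by finite sets: $f\colon X\to Y$ has entries $f_x^y$; composition is $(g\circ f)_a^c=\sum_b f_a^bg_b^c$; $S\otimes S=S\times S$; $I=\{*\}$; $f^\dagger$ is the transpose. Thus $(\dot\nabla\circ\dot\nabla^\dagger)_a^b=\sum_{p,q\in S}\dot\nabla_{pq}^a\dot\nabla_{pq}^b$. A coherent configuration $(X,S)$ is a finite set $X$ with a partition $S$ of $X\times X$ such that: if $p\in S$ contains some $(x,x)$ then $p\subseteq\mathrm{id}_X$; for $a,b,c\in S$ the number $\nabla_{ab}^c$ of $z\in X$ with $(x,z)\in a$, $(z,y)\in b$ is the same for all $(x,y)\in c$; and $c\in S$ implies $c^{ -1}=\{(y,x):(x,y)\in c\}\in S$. The valency $\|a\|$ of $a\in S$ is the number of $y\in X$ with $(x,y)\in a$, for any $x$ for which at least one such $y$ exists (independent of $x$). The unit $e\colon I\to S$ has $e_*^a=1$ if $a\subseteq\mathrm{id}_X$ and $0$ otherwise. -}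

module Defs where

open import Level using (0ℓ)
open import Algebra.Bundles.Raw using (RawMonoid)
import Algebra.Definitions.RawMonoid as RawMonoidDefs
open import Data.Bool using (Bool; true; T; T?; if_then_else_; _∧_)
open import Data.Fin using (Fin)
import Data.Fin.Properties as Fin
open import Data.Fin.Subset using (∣_∣)
import Data.Fin.Subset.Properties as Subset
open import Data.Integer as ℤ using (+_)
import Data.Integer.Properties as ℤ
import Data.Integer.Solver as ℤ
open import Data.Nat as ℕ using (ℕ; zero; suc; NonZero)
import Data.Nat.Properties as ℕ
import Data.Nat.DivMod as ℕ
open import Data.Product using (Σ; ∃; _×_; _,_)
open import Data.Product.Function.NonDependent.Propositional using (_×-↔_)
open import Data.Rational as ℚ using (ℚ; 0ℚ; 1ℚ; ½; ↥_; ↧ₙ_)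
import Data.Rational.Properties as ℚ
open import Data.Rational.Solver using (module +-*-Solver)
open import Data.Rational.Unnormalised as ℚᵘ using (mkℚᵘ)
import Data.Rational.Unnormalised.Properties as ℚᵘ
open import Data.Sum using (inj₁; inj₂)
open import Data.Unit using (⊤)
open import Data.Vec using (tabulate)
open import Function.Bundles using (Inverse; _↔_; _⇔_)
open import Function.Construct.Composition using (_↔-∘_)
open import Relation.Binary.PropositionalEquality
open import Relation.Nullary using (¬_; Dec; yes; no; does)
open import Relation.Nullary.Decidable using (_→-dec_)

p≡q+[p-q] : ∀ p q → p ≡ q ℚ.+ (p ℚ.- q)
p≡q+[p-q] = solve 2 (λ p q → p := q :+ (p :- q)) refl
  where open +-*-Solver

near⇒≤ : ∀ p q {ε} → ℚ.∣ p ℚ.- q ∣ ℚ.≤ ε → p ℚ.≤ q ℚ.+ ε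
near⇒≤ p q {ε} h = begin
  p                        ≡⟨ p≡q+[p-q] p q ⟩
  q ℚ.+ (p ℚ.- q)          ≤⟨ ℚ.+-monoʳ-≤ q (≤∣∣ (p ℚ.- q)) ⟩
  q ℚ.+ ℚ.∣ p ℚ.- q ∣      ≤⟨ ℚ.+-monoʳ-≤ q h ⟩
  q ℚ.+ ε                  ∎
  where
  open ℚ.≤-Reasoning
  ≤∣∣ : ∀ x → x ℚ.≤ ℚ.∣ x ∣
  ≤∣∣ x with ℚ.≤-total 0ℚ x
  ... | inj₁ 0≤x = ℚ.≤-reflexive (sym (ℚ.0≤p⇒∣p∣≡p 0≤x))
  ... | inj₂ x≤0 = ℚ.≤-trans x≤0 (ℚ.0≤∣p∣ x)

≤⇒near : ∀ p q {ε} → p ℚ.≤ q ℚ.+ ε → q ℚ.≤ p ℚ.+ ε → ℚ.∣ p ℚ.- q ∣ ℚ.≤ ε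
≤⇒near p q {ε} h₁ h₂ with ℚ.∣p∣≡p∨∣p∣≡-p (p ℚ.- q)
... | inj₁ eq rewrite eq = begin
  p ℚ.- q            ≤⟨ ℚ.+-monoˡ-≤ (ℚ.- q) h₁ ⟩
  (q ℚ.+ ε) ℚ.- q    ≡⟨ solve 2 (λ q ε → (q :+ ε) :- q := ε) refl q ε ⟩
  ε                  ∎
  where open ℚ.≤-Reasoning
        open +-*-Solver
... | inj₂ eq rewrite eq = begin
  ℚ.- (p ℚ.- q)      ≡⟨ solve 2 (λ p q → :- (p :- q) := q :- p) refl p q ⟩
  q ℚ.- p            ≤⟨ ℚ.+-monoˡ-≤ (ℚ.- p) h₂ ⟩
  (p ℚ.+ ε) ℚ.- p    ≡⟨ solve 2 (λ p ε → (p :+ ε) :- p := ε) refl p ε ⟩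
  ε                  ∎
  where open ℚ.≤-Reasoning
        open +-*-Solver

half-pos : ∀ {ε} → 0ℚ ℚ.< ε → 0ℚ ℚ.< ½ ℚ.* ε
half-pos {ε} 0<ε =
  subst (ℚ._< ½ ℚ.* ε) (ℚ.*-zeroʳ ½) (ℚ.*-monoʳ-<-pos ½ 0<ε)

halves : ∀ ε → ½ ℚ.* ε ℚ.+ ½ ℚ.* ε ≡ ε
halves ε = trans (sym (ℚ.*-distribʳ-+ ε ½ ½)) (ℚ.*-identityˡ ε)

0≤+ : ∀ {p q} → 0ℚ ℚ.≤ p → 0ℚ ℚ.≤ q → 0ℚ ℚ.≤ p ℚ.+ q
0≤+ = ℚ.+-mono-≤

ℚ-*-mono-≤ : ∀ {p q r s} → 0ℚ ℚ.≤ p → 0ℚ ℚ.≤ s →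
           p ℚ.≤ q → r ℚ.≤ s → p ℚ.* r ℚ.≤ q ℚ.* s
ℚ-*-mono-≤ {p} {s = s} 0≤p 0≤s p≤q r≤s = ℚ.≤-trans
  (ℚ.*-monoˡ-≤-nonNeg p {{ℚ.nonNegative 0≤p}} r≤s)
  (ℚ.*-monoʳ-≤-nonNeg s {{ℚ.nonNegative 0≤s}} p≤q)

0≤* : ∀ {p q} → 0ℚ ℚ.≤ p → 0ℚ ℚ.≤ q → 0ℚ ℚ.≤ p ℚ.* q
0≤* 0≤p 0≤q = ℚ-*-mono-≤ ℚ.≤-refl 0≤q 0≤p 0≤q

-- The non-negative reals [0,∞), constructed as the Cauchy completion of the
-- non-negative rationals.  Equality of reals is the setoid equality _≈_.

infix 4 _≈_

record ℝ≥0 : Set where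
  constructor mkℝ≥0
  field
    seq    : ℕ → ℚ
    0≤seq  : ∀ k → 0ℚ ℚ.≤ seq k
    cauchy : ∀ ε → 0ℚ ℚ.< ε → ∃ λ N → ∀ j k → N ℕ.≤ j → N ℕ.≤ k →
             ℚ.∣ seq j ℚ.- seq k ∣ ℚ.≤ ε
open ℝ≥0 public

_≈_ : ℝ≥0 → ℝ≥0 → Set
x ≈ y = ∀ ε → 0ℚ ℚ.< ε → ∃ λ N → ∀ k → N ℕ.≤ k →
        ℚ.∣ seq x k ℚ.- seq y k ∣ ℚ.≤ ε

-- The operations are opaque only to keep type checking tractable; their
-- approximating sequences are given by seq-fromℚ, seq-+, seq-* and seq-√.
opaque
  fromℚ : (q : ℚ) → 0ℚ ℚ.≤ q → ℝ≥0
  fromℚ q 0≤q = mkℝ≥0 (λ _ → q) (λ _ → 0≤q)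
    (λ ε 0<ε → 0 , λ _ _ _ _ →
      subst (λ d → ℚ.∣ d ∣ ℚ.≤ ε) (sym (ℚ.+-inverseʳ q)) (ℚ.<⇒≤ 0<ε))

  seq-fromℚ : ∀ q 0≤q k → seq (fromℚ q 0≤q) k ≡ q
  seq-fromℚ q 0≤q k = refl

0≤/ : ∀ m d .{{_ : NonZero d}} → 0ℚ ℚ.≤ + m ℚ./ d
0≤/ m d = ℚ.nonNegative⁻¹ _ {{ℚ.normalize-nonNeg m d}}

ratio : (m d : ℕ) .{{_ : NonZero d}} → ℝ≥0
ratio m d = fromℚ (+ m ℚ./ d) (0≤/ m d)

fromℕ : ℕ → ℝ≥0
fromℕ m = ratio m 1

infixl 6 _+_
infixl 7 _*_

opaque
  _+_ : ℝ≥0 → ℝ≥0 → ℝ≥0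
  x + y = mkℝ≥0 (λ k → seq x k ℚ.+ seq y k)
                (λ k → 0≤+ (0≤seq x k) (0≤seq y k)) c
    where
    c : ∀ ε → 0ℚ ℚ.< ε → ∃ λ N → ∀ j k → N ℕ.≤ j → N ℕ.≤ k →
        ℚ.∣ (seq x j ℚ.+ seq y j) ℚ.- (seq x k ℚ.+ seq y k) ∣ ℚ.≤ ε
    c ε 0<ε with cauchy x _ (half-pos 0<ε) | cauchy y _ (half-pos 0<ε)
    ... | N , hx | M , hy = N ℕ.⊔ M , λ j k N⊔M≤j N⊔M≤k →
      let N≤j = ℕ.m⊔n≤o⇒m≤o N M N⊔M≤j ; M≤j = ℕ.m⊔n≤o⇒n≤o N M N⊔M≤j
          N≤k = ℕ.m⊔n≤o⇒m≤o N M N⊔M≤k ; M≤k = ℕ.m⊔n≤o⇒n≤o N M N⊔M≤k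
      in ≤⇒near (seq x j ℚ.+ seq y j) (seq x k ℚ.+ seq y k)
                (one j k (hx j k N≤j N≤k) (hy j k M≤j M≤k))
                (one k j (hx k j N≤k N≤j) (hy k j M≤k M≤j))
      where
      open ℚ.≤-Reasoning
      one : ∀ j k → ℚ.∣ seq x j ℚ.- seq x k ∣ ℚ.≤ ½ ℚ.* ε →
            ℚ.∣ seq y j ℚ.- seq y k ∣ ℚ.≤ ½ ℚ.* ε →
            seq x j ℚ.+ seq y j ℚ.≤ (seq x k ℚ.+ seq y k) ℚ.+ ε
      one j k hx hy = begin
        seq x j ℚ.+ seq y j
          ≤⟨ ℚ.+-mono-≤ (near⇒≤ (seq x j) (seq x k) hx) (near⇒≤ (seq y j) (seq y k) hy) ⟩
        (seq x k ℚ.+ ½ ℚ.* ε) ℚ.+ (seq y k ℚ.+ ½ ℚ.* ε)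
          ≡⟨ solve 3 (λ a b h → (a :+ h) :+ (b :+ h) := (a :+ b) :+ (h :+ h))
               refl (seq x k) (seq y k) (½ ℚ.* ε) ⟩
        (seq x k ℚ.+ seq y k) ℚ.+ (½ ℚ.* ε ℚ.+ ½ ℚ.* ε)
          ≡⟨ cong (seq x k ℚ.+ seq y k ℚ.+_) (halves ε) ⟩
        (seq x k ℚ.+ seq y k) ℚ.+ ε ∎
        where open +-*-Solver

  seq-+ : ∀ x y k → seq (x + y) k ≡ seq x k ℚ.+ seq y k
  seq-+ x y k = refl

-- an eventual positive bound on x
bounded : ∀ x → ∃ λ N → Σ ℚ λ b → 0ℚ ℚ.< b × (∀ k → N ℕ.≤ k → seq x k ℚ.≤ b)
bounded x with cauchy x 1ℚ (ℚ.positive⁻¹ 1ℚ)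
... | N , h = N , seq x N ℚ.+ 1ℚ
            , ℚ.+-mono-≤-< (0≤seq x N) (ℚ.positive⁻¹ 1ℚ)
            , λ k N≤k → near⇒≤ (seq x k) (seq x N) (h k N N≤k ℕ.≤-refl)

divide : ∀ {b h} → 0ℚ ℚ.< b → 0ℚ ℚ.< h →
         Σ ℚ λ δ → 0ℚ ℚ.< δ × b ℚ.* δ ≡ h
divide {b} {h} 0<b 0<h = 1/b ℚ.* h
  , ℚ.positive⁻¹ _ {{ℚ.pos*pos⇒pos 1/b {{ℚ.1/pos⇒pos b}} h}}
  , (begin
    b ℚ.* (1/b ℚ.* h)    ≡⟨ ℚ.*-assoc b 1/b h ⟨
    (b ℚ.* 1/b) ℚ.* h    ≡⟨ cong (ℚ._* h) (ℚ.*-inverseʳ b) ⟩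
    1ℚ ℚ.* h             ≡⟨ ℚ.*-identityˡ h ⟩
    h                    ∎)
  where
  open ≡-Reasoning
  instance
    b-pos = ℚ.positive 0<b
    h-pos = ℚ.positive 0<h
    b-nonZero = ℚ.pos⇒nonZero b
  1/b = ℚ.1/ b

*-near : ∀ a a′ b b′ {A B δ δ′ h} →
         0ℚ ℚ.≤ a → 0ℚ ℚ.≤ b′ → 0ℚ ℚ.≤ δ → 0ℚ ℚ.≤ δ′ →
         a ℚ.≤ A → b′ ℚ.≤ B → a ℚ.≤ a′ ℚ.+ δ′ → b ℚ.≤ b′ ℚ.+ δ →
         A ℚ.* δ ≡ h → B ℚ.* δ′ ≡ h →
         a ℚ.* b ℚ.≤ a′ ℚ.* b′ ℚ.+ (h ℚ.+ h)
*-near a a′ b b′ {A} {B} {δ} {δ′} {h} 0≤a 0≤b′ 0≤δ 0≤δ′ a≤A b′≤B a≤ b≤ Aδ Bδ′ =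
  begin
    a ℚ.* b
      ≤⟨ ℚ.*-monoˡ-≤-nonNeg a {{ℚ.nonNegative 0≤a}} {b} {b′ ℚ.+ δ} b≤ ⟩
    a ℚ.* (b′ ℚ.+ δ)
      ≡⟨ ℚ.*-distribˡ-+ a b′ δ ⟩
    a ℚ.* b′ ℚ.+ a ℚ.* δ
      ≤⟨ ℚ.+-mono-≤ {a ℚ.* b′} {(a′ ℚ.+ δ′) ℚ.* b′} {a ℚ.* δ} {A ℚ.* δ}
           (ℚ.*-monoʳ-≤-nonNeg b′ {{ℚ.nonNegative 0≤b′}} {a} {a′ ℚ.+ δ′} a≤)
           (ℚ.*-monoʳ-≤-nonNeg δ {{ℚ.nonNegative 0≤δ}} {a} {A} a≤A) ⟩
    (a′ ℚ.+ δ′) ℚ.* b′ ℚ.+ A ℚ.* δ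
      ≡⟨ solve 4 (λ a′ δ′ b′ e → (a′ :+ δ′) :* b′ :+ e :=
           a′ :* b′ :+ (b′ :* δ′ :+ e)) refl a′ δ′ b′ (A ℚ.* δ) ⟩
    a′ ℚ.* b′ ℚ.+ (b′ ℚ.* δ′ ℚ.+ A ℚ.* δ)
      ≤⟨ ℚ.+-monoʳ-≤ (a′ ℚ.* b′)
           {b′ ℚ.* δ′ ℚ.+ A ℚ.* δ} {B ℚ.* δ′ ℚ.+ A ℚ.* δ}
           (ℚ.+-monoˡ-≤ (A ℚ.* δ) {b′ ℚ.* δ′} {B ℚ.* δ′}
             (ℚ.*-monoʳ-≤-nonNeg δ′ {{ℚ.nonNegative 0≤δ′}} {b′} {B} b′≤B)) ⟩
    a′ ℚ.* b′ ℚ.+ (B ℚ.* δ′ ℚ.+ A ℚ.* δ)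
      ≡⟨ cong₂ (λ u v → a′ ℚ.* b′ ℚ.+ (u ℚ.+ v)) Bδ′ Aδ ⟩
    a′ ℚ.* b′ ℚ.+ (h ℚ.+ h) ∎
  where open ℚ.≤-Reasoning
        open +-*-Solver

opaque
  _*_ : ℝ≥0 → ℝ≥0 → ℝ≥0
  x * y = mkℝ≥0 (λ k → seq x k ℚ.* seq y k)
                (λ k → 0≤* (0≤seq x k) (0≤seq y k)) c
    where
    c : ∀ ε → 0ℚ ℚ.< ε → ∃ λ N → ∀ j k → N ℕ.≤ j → N ℕ.≤ k →
        ℚ.∣ (seq x j ℚ.* seq y j) ℚ.- (seq x k ℚ.* seq y k) ∣ ℚ.≤ ε
    c ε 0<ε =
      let Nx , A , 0<A , x≤A = bounded x
          Ny , B , 0<B , y≤B = bounded y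
          δ , 0<δ , Aδ       = divide 0<A (half-pos 0<ε)
          δ′ , 0<δ′ , Bδ′    = divide 0<B (half-pos 0<ε)
          Mx , hx            = cauchy x δ′ 0<δ′
          My , hy            = cauchy y δ 0<δ
          N = Nx ℕ.⊔ Ny
          M = Mx ℕ.⊔ My
          one : ∀ j k → N ℕ.⊔ M ℕ.≤ j → N ℕ.⊔ M ℕ.≤ k →
                seq x j ℚ.* seq y j ℚ.≤ seq x k ℚ.* seq y k ℚ.+ ε
          one = λ j k Nj Nk →
            let Nx≤j = ℕ.m⊔n≤o⇒m≤o Nx Ny (ℕ.m⊔n≤o⇒m≤o N M Nj)
                Ny≤k = ℕ.m⊔n≤o⇒n≤o Nx Ny (ℕ.m⊔n≤o⇒m≤o N M Nk)
                Mx≤j = ℕ.m⊔n≤o⇒m≤o Mx My (ℕ.m⊔n≤o⇒n≤o N M Nj)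
                Mx≤k = ℕ.m⊔n≤o⇒m≤o Mx My (ℕ.m⊔n≤o⇒n≤o N M Nk)
                My≤j = ℕ.m⊔n≤o⇒n≤o Mx My (ℕ.m⊔n≤o⇒n≤o N M Nj)
                My≤k = ℕ.m⊔n≤o⇒n≤o Mx My (ℕ.m⊔n≤o⇒n≤o N M Nk)
            in subst (λ e → seq x j ℚ.* seq y j ℚ.≤ seq x k ℚ.* seq y k ℚ.+ e)
                 (halves ε)
                 (*-near (seq x j) (seq x k) (seq y j) (seq y k) {A} {B} {δ} {δ′}
                   (0≤seq x j) (0≤seq y k) (ℚ.<⇒≤ 0<δ) (ℚ.<⇒≤ 0<δ′)
                   (x≤A j Nx≤j) (y≤B k Ny≤k)
                   (near⇒≤ (seq x j) (seq x k) (hx j k Mx≤j Mx≤k))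
                   (near⇒≤ (seq y j) (seq y k) (hy j k My≤j My≤k)) Aδ Bδ′)
      in N ℕ.⊔ M , λ j k Nj Nk →
           ≤⇒near (seq x j ℚ.* seq y j) (seq x k ℚ.* seq y k)
             (one j k Nj Nk) (one k j Nk Nj)

  seq-* : ∀ x y k → seq (x * y) k ≡ seq x k ℚ.* seq y k
  seq-* x y k = refl

isqrt : ℕ → ℕ
isqrt zero    = zero
isqrt (suc n) with suc (isqrt n) ℕ.* suc (isqrt n) ℕ.≤? suc n
... | yes _ = suc (isqrt n)
... | no  _ = isqrt n

isqrt-≤ : ∀ n → isqrt n ℕ.* isqrt n ℕ.≤ n
isqrt-≤ zero = ℕ.z≤n
isqrt-≤ (suc n) with suc (isqrt n) ℕ.* suc (isqrt n) ℕ.≤? suc n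
... | yes p = p
... | no  _ = ℕ.m≤n⇒m≤1+n (isqrt-≤ n)

isqrt-> : ∀ n → n ℕ.< suc (isqrt n) ℕ.* suc (isqrt n)
isqrt-> zero = ℕ.s≤s ℕ.z≤n
isqrt-> (suc n) with suc (isqrt n) ℕ.* suc (isqrt n) ℕ.≤? suc n
... | yes _ = ℕ.≤-<-trans (isqrt-> n)
                (ℕ.*-mono-< (ℕ.n<1+n (suc (isqrt n))) (ℕ.n<1+n (suc (isqrt n))))
... | no ¬p = ℕ.≰⇒> ¬p

-- For r ≥ 0 and K = k + 1, the largest multiple of 1/K whose square is at
-- most r; thus √-approx k r ≤ √ r < √-approx k r + 1/K.
√-num : ℕ → ℚ → ℕ
√-num k r = isqrt (ℤ.∣ ↥ r ∣ ℕ.* (suc k ℕ.* suc k) ℕ./ ↧ₙ r)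

√-approx : ℕ → ℚ → ℚ
√-approx k r = + √-num k r ℚ./ suc k

√-mesh : ℕ → ℚ
√-mesh k = + 1 ℚ./ suc k

frac : ℕ → ℕ → ℚ
frac a c = + a ℚ./ suc c

toℚᵘ-frac : ∀ a c → ℚ.toℚᵘ (frac a c) ℚᵘ.≃ mkℚᵘ (+ a) c
toℚᵘ-frac a c = ℚ.toℚᵘ-fromℚᵘ (mkℚᵘ (+ a) c)

frac-≤ : ∀ a c b d → a ℕ.* suc d ℕ.≤ b ℕ.* suc c → frac a c ℚ.≤ frac b d
frac-≤ a c b d h = ℚ.toℚᵘ-cancel-≤
  (ℚᵘ.≤-respˡ-≃ (ℚᵘ.≃-sym (toℚᵘ-frac a c))
    (ℚᵘ.≤-respʳ-≃ (ℚᵘ.≃-sym (toℚᵘ-frac b d))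
      (ℚᵘ.*≤* (subst₂ ℤ._≤_ (ℤ.pos-* a (suc d)) (ℤ.pos-* b (suc c)) (ℤ.+≤+ h)))))

frac-< : ∀ a c b d → a ℕ.* suc d ℕ.< b ℕ.* suc c → frac a c ℚ.< frac b d
frac-< a c b d h = ℚ.toℚᵘ-cancel-<
  (ℚᵘ.<-respˡ-≃ (ℚᵘ.≃-sym (toℚᵘ-frac a c))
    (ℚᵘ.<-respʳ-≃ (ℚᵘ.≃-sym (toℚᵘ-frac b d))
      (ℚᵘ.*<* (subst₂ ℤ._<_ (ℤ.pos-* a (suc d)) (ℤ.pos-* b (suc c)) (ℤ.+<+ h)))))

frac-square : ∀ a c → frac a c ℚ.* frac a c ≡ frac (a ℕ.* a) (c ℕ.+ c ℕ.* suc c)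
frac-square a c = ℚ.toℚᵘ-injective (begin
  ℚ.toℚᵘ (frac a c ℚ.* frac a c)
    ≈⟨ ℚ.toℚᵘ-homo-* (frac a c) (frac a c) ⟩
  ℚ.toℚᵘ (frac a c) ℚᵘ.* ℚ.toℚᵘ (frac a c)
    ≈⟨ ℚᵘ.*-cong (toℚᵘ-frac a c) (toℚᵘ-frac a c) ⟩
  mkℚᵘ (+ a ℤ.* + a) (c ℕ.+ c ℕ.* suc c)
    ≡⟨ cong (λ n → mkℚᵘ n (c ℕ.+ c ℕ.* suc c)) (sym (ℤ.pos-* a a)) ⟩
  mkℚᵘ (+ (a ℕ.* a)) (c ℕ.+ c ℕ.* suc c)
    ≈⟨ toℚᵘ-frac (a ℕ.* a) (c ℕ.+ c ℕ.* suc c) ⟨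
  ℚ.toℚᵘ (frac (a ℕ.* a) (c ℕ.+ c ℕ.* suc c)) ∎)
  where open ℚᵘ.≃-Reasoning

frac-suc : ∀ a c → frac a c ℚ.+ frac 1 c ≡ frac (suc a) c
frac-suc a c = ℚ.toℚᵘ-injective (begin
  ℚ.toℚᵘ (frac a c ℚ.+ frac 1 c)
    ≈⟨ ℚ.toℚᵘ-homo-+ (frac a c) (frac 1 c) ⟩
  ℚ.toℚᵘ (frac a c) ℚᵘ.+ ℚ.toℚᵘ (frac 1 c)
    ≈⟨ ℚᵘ.+-cong (toℚᵘ-frac a c) (toℚᵘ-frac 1 c) ⟩
  mkℚᵘ (+ a) c ℚᵘ.+ mkℚᵘ (+ 1) c
    ≈⟨ ℚᵘ.*≡* (trans
         (solve 2 (λ a k → (a :* k :+ con (+ 1) :* k) :* k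
                        := (con (+ 1) :+ a) :* (k :* k)) refl (+ a) (+ suc c))
         (cong (+ suc a ℤ.*_) (sym (ℤ.pos-* (suc c) (suc c))))) ⟩
  mkℚᵘ (+ suc a) c
    ≈⟨ toℚᵘ-frac (suc a) c ⟨
  ℚ.toℚᵘ (frac (suc a) c) ∎)
  where open ℚᵘ.≃-Reasoning
        open ℤ.+-*-Solver

√-approx-≤ : ∀ k r → 0ℚ ℚ.≤ r → √-approx k r ℚ.* √-approx k r ℚ.≤ r
√-approx-≤ k (ℚ.mkℚ ℤ.-[1+ _ ] _ _) 0≤r with ℚ.nonNegative 0≤r
... | record { nonNeg = () }
√-approx-≤ k r@(ℚ.mkℚ (+ p) d _) 0≤r =
  subst₂ ℚ._≤_ (sym (frac-square i k)) (ℚ.↥p/↧p≡p r)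
    (frac-≤ (i ℕ.* i) (k ℕ.+ k ℕ.* suc k) p d (begin
      i ℕ.* i ℕ.* suc d        ≤⟨ ℕ.*-monoˡ-≤ (suc d) (isqrt-≤ (m ℕ./ suc d)) ⟩
      m ℕ./ suc d ℕ.* suc d    ≤⟨ ℕ.m/n*n≤m m (suc d) ⟩
      m                        ∎))
  where
  open ℕ.≤-Reasoning
  m = p ℕ.* (suc k ℕ.* suc k)
  i = √-num k r

√-approx-> : ∀ k r → 0ℚ ℚ.≤ r →
  r ℚ.< (√-approx k r ℚ.+ √-mesh k) ℚ.* (√-approx k r ℚ.+ √-mesh k)
√-approx-> k (ℚ.mkℚ ℤ.-[1+ _ ] _ _) 0≤r with ℚ.nonNegative 0≤r
... | record { nonNeg = () }
√-approx-> k r@(ℚ.mkℚ (+ p) d _) 0≤r =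
  subst₂ ℚ._<_ (ℚ.↥p/↧p≡p r)
    (trans (sym (frac-square (suc i) k))
           (cong (λ q → q ℚ.* q) (sym (frac-suc i k))))
    (frac-< p d (suc i ℕ.* suc i) (k ℕ.+ k ℕ.* suc k) (begin-strict
      m                                                ≡⟨ ℕ.m≡m%n+[m/n]*n m (suc d) ⟩
      m ℕ.% suc d ℕ.+ m ℕ./ suc d ℕ.* suc d            <⟨ ℕ.+-monoˡ-< (m ℕ./ suc d ℕ.* suc d) (ℕ.m%n<n m (suc d)) ⟩
      suc (m ℕ./ suc d) ℕ.* suc d                      ≤⟨ ℕ.*-monoˡ-≤ (suc d) (isqrt-> (m ℕ./ suc d)) ⟩
      suc i ℕ.* suc i ℕ.* suc d                        ∎))
  where
  open ℕ.≤-Reasoning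
  m = p ℕ.* (suc k ℕ.* suc k)
  i = √-num k r

√-mesh-small : ∀ ε → 0ℚ ℚ.< ε → ∃ λ N → ∀ k → N ℕ.≤ k → √-mesh k ℚ.≤ ε
√-mesh-small (ℚ.mkℚ ℤ.-[1+ _ ] _ _) 0<ε with ℚ.positive 0<ε
... | record { pos = () }
√-mesh-small (ℚ.mkℚ (+ zero) _ _) 0<ε with ℚ.positive 0<ε
... | record { pos = () }
√-mesh-small ε@(ℚ.mkℚ (+ suc p) d _) 0<ε = d , λ k d≤k →
  subst (√-mesh k ℚ.≤_) (ℚ.↥p/↧p≡p ε)
    (frac-≤ 1 k (suc p) d
      (ℕ.*-mono-≤ {1} {suc p} (ℕ.s≤s ℕ.z≤n) (ℕ.s≤s d≤k)))

√-near : ∀ s s′ x x′ g {h} → 0ℚ ℚ.≤ s′ → 0ℚ ℚ.≤ g → 0ℚ ℚ.≤ h → g ℚ.≤ h →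
         s ℚ.* s ℚ.≤ x → x′ ℚ.< (s′ ℚ.+ g) ℚ.* (s′ ℚ.+ g) →
         x ℚ.≤ x′ ℚ.+ h ℚ.* h → s ℚ.≤ s′ ℚ.+ (h ℚ.+ h)
√-near s s′ x x′ g {h} 0≤s′ 0≤g 0≤h g≤h s²≤x x′<t² x≤ = ℚ.≮⇒≥ λ <s →
  ℚ.<-irrefl {x} {x} refl (begin-strict
    x
      ≤⟨ x≤ ⟩
    x′ ℚ.+ h ℚ.* h
      <⟨ ℚ.+-monoˡ-< (h ℚ.* h) x′<t² ⟩
    t ℚ.* t ℚ.+ h ℚ.* h
      ≡⟨ ℚ.+-identityʳ _ ⟨
    t ℚ.* t ℚ.+ h ℚ.* h ℚ.+ 0ℚ
      ≤⟨ ℚ.+-monoʳ-≤ (t ℚ.* t ℚ.+ h ℚ.* h) (0≤+ (0≤* 0≤t 0≤h) (0≤* 0≤t 0≤h)) ⟩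
    t ℚ.* t ℚ.+ h ℚ.* h ℚ.+ (t ℚ.* h ℚ.+ t ℚ.* h)
      ≡⟨ solve 2 (λ t h → t :* t :+ h :* h :+ (t :* h :+ t :* h)
                       := (t :+ h) :* (t :+ h)) refl t h ⟩
    (t ℚ.+ h) ℚ.* (t ℚ.+ h)
      ≤⟨ ℚ-*-mono-≤ {t ℚ.+ h} {s} {t ℚ.+ h} {s} (0≤+ 0≤t 0≤h)
           (ℚ.≤-trans (0≤+ 0≤t 0≤h) (t+h≤s <s)) (t+h≤s <s) (t+h≤s <s) ⟩
    s ℚ.* s
      ≤⟨ s²≤x ⟩
    x ∎)
  where
  open ℚ.≤-Reasoning
  open +-*-Solver
  t = s′ ℚ.+ g
  0≤t = 0≤+ 0≤s′ 0≤g
  t+h≤s : s′ ℚ.+ (h ℚ.+ h) ℚ.< s → t ℚ.+ h ℚ.≤ s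
  t+h≤s <s = begin
    (s′ ℚ.+ g) ℚ.+ h    ≤⟨ ℚ.+-monoˡ-≤ h (ℚ.+-monoʳ-≤ s′ g≤h) ⟩
    (s′ ℚ.+ h) ℚ.+ h    ≡⟨ ℚ.+-assoc s′ h h ⟩
    s′ ℚ.+ (h ℚ.+ h)    <⟨ <s ⟩
    s                   ∎

opaque
  √ : ℝ≥0 → ℝ≥0
  √ x = mkℝ≥0 s 0≤s c
    where
    s : ℕ → ℚ
    s k = √-approx k (seq x k)

    0≤s : ∀ k → 0ℚ ℚ.≤ s k
    0≤s k = 0≤/ (√-num k (seq x k)) (suc k)

    c : ∀ ε → 0ℚ ℚ.< ε → ∃ λ N → ∀ j k → N ℕ.≤ j → N ℕ.≤ k →
        ℚ.∣ s j ℚ.- s k ∣ ℚ.≤ ε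
    c ε 0<ε =
      let h = ½ ℚ.* ε
          0<h = half-pos 0<ε
          N , hx = cauchy x (h ℚ.* h)
            (ℚ.positive⁻¹ _ {{ℚ.pos*pos⇒pos h {{ℚ.positive 0<h}} h {{ℚ.positive 0<h}}}})
          M , mesh = √-mesh-small h 0<h
          one : ∀ j k → N ℕ.⊔ M ℕ.≤ j → N ℕ.⊔ M ℕ.≤ k → s j ℚ.≤ s k ℚ.+ ε
          one = λ j k Nj Nk →
            subst (λ e → s j ℚ.≤ s k ℚ.+ e) (halves ε)
              (√-near (s j) (s k) (seq x j) (seq x k) (√-mesh k) {h}
                (0≤s k) (0≤/ 1 (suc k)) (ℚ.<⇒≤ 0<h)
                (mesh k (ℕ.m⊔n≤o⇒n≤o N M Nk))
                (√-approx-≤ j (seq x j) (0≤seq x j))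
                (√-approx-> k (seq x k) (0≤seq x k))
                (near⇒≤ (seq x j) (seq x k)
                  (hx j k (ℕ.m⊔n≤o⇒m≤o N M Nj) (ℕ.m⊔n≤o⇒m≤o N M Nk))))
      in N ℕ.⊔ M , λ j k Nj Nk →
           ≤⇒near (s j) (s k) (one j k Nj Nk) (one k j Nk Nj)

  seq-√ : ∀ x k → seq (√ x) k ≡ √-approx k (seq x k)
  seq-√ x k = refl

-- Finite sets are types with a chosen enumeration; no statement below depends
-- on the choice, which only fixes the order of summation and counting.
record FinSet : Set₁ where
  field
    Carrier : Set
    card    : ℕ
    enum    : Fin card ↔ Carrier

  element : Fin card → Carrier
  element = Inverse.to enum
open FinSet public using (Carrier; card; enum; element)

infixr 8 _⊗_

_⊗_ : FinSet → FinSet → FinSet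
A ⊗ B = record
  { Carrier = Carrier A × Carrier B
  ; card    = card A ℕ.* card B
  ; enum    = (enum A ×-↔ enum B) ↔-∘ Fin.*↔×
  }

I : FinSet
I = record { Carrier = ⊤ ; card = 1 ; enum = Fin.1↔⊤ }

count : (A : FinSet) → (Carrier A → Bool) → ℕ
count A P = ∣ tabulate (λ i → P (element A i)) ∣

+-0-rawMonoid : RawMonoid 0ℓ 0ℓ
+-0-rawMonoid = record { _≈_ = _≈_ ; _∙_ = _+_ ; ε = fromℕ 0 }

∑ : (A : FinSet) → (Carrier A → ℝ≥0) → ℝ≥0
∑ A f = RawMonoidDefs.sum +-0-rawMonoid (λ i → f (element A i))

-- entry f x y has source index x and target index y.
record Matrix (A B : FinSet) : Set where
  constructor matrix
  field entry : Carrier A → Carrier B → ℝ≥0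
open Matrix public

infix  4 _≐_
infixr 8 _•_
infixr 9 _∘_
infix  10 _†

_≐_ : ∀ {A B} → Matrix A B → Matrix A B → Set
f ≐ g = ∀ x y → entry f x y ≈ entry g x y

_∘_ : ∀ {A B C} → Matrix B C → Matrix A B → Matrix A C
_∘_ {B = B} g f = matrix λ a c → ∑ B (λ b → entry f a b * entry g b c)

_† : ∀ {A B} → Matrix A B → Matrix B A
f † = matrix λ y x → entry f x y

_•_ : ∀ {A B} → ℝ≥0 → Matrix A B → Matrix A B
r • f = matrix λ x y → r * entry f x y

zeroMatrix : ∀ {A B} → Matrix A B
zeroMatrix = matrix λ _ _ → fromℕ 0

IsEigenvector : ∀ {A} → Matrix A A → Matrix I A → ℝ≥0 → Set
IsEigenvector M v r = ¬ (v ≐ zeroMatrix) × M ∘ v ≐ r • v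

-- The set S of relations is represented by an index set together with the
-- (necessarily injective) family rel of decidable subsets of X × X: the blocks
-- are nonempty, they cover X × X, and a pair lies in only one of them.
record CoherentConfiguration (X : FinSet) : Set₁ where
  field
    S   : FinSet
    rel : Carrier S → Carrier X → Carrier X → Bool

  infix 4 _⟨_⟩_
  _⟨_⟩_ : Carrier X → Carrier S → Carrier X → Set
  x ⟨ a ⟩ y = T (rel a x y)

  paths : (a b : Carrier S) → (x y : Carrier X) → ℕ
  paths a b x y = count X (λ z → rel a x z ∧ rel b z y)

  field
    nonempty : ∀ a → ∃ λ x → ∃ λ y → x ⟨ a ⟩ y
    cover    : ∀ x y → ∃ λ a → x ⟨ a ⟩ y
    disjoint : ∀ {a b x y} → x ⟨ a ⟩ y → x ⟨ b ⟩ y → a ≡ b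

    diagonal : ∀ {p x} → x ⟨ p ⟩ x → ∀ {y z} → y ⟨ p ⟩ z → y ≡ z
    regular  : ∀ a b c {x y x′ y′} → x ⟨ c ⟩ y → x′ ⟨ c ⟩ y′ →
               paths a b x y ≡ paths a b x′ y′
    converse : ∀ c → ∃ λ c⁻¹ → ∀ x y → x ⟨ c⁻¹ ⟩ y ⇔ y ⟨ c ⟩ x

  -- ∇ and valency count at the pair chosen by nonempty; the counts do not
  -- depend on that choice.
  ∇ : (a b c : Carrier S) → ℕ
  ∇ a b c = let x , y , _ = nonempty c in paths a b x y

  valency : Carrier S → ℕ
  valency a = let x , _ = nonempty a in count X (rel a x)

  ⊆id? : ∀ a → Dec (∀ i j → element X i ⟨ a ⟩ element X j → i ≡ j)
  ⊆id? a = Fin.all? λ i → Fin.all? λ j →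
           T? (rel a (element X i) (element X j)) →-dec (i Fin.≟ j)

  valency-nonZero : ∀ a → NonZero (valency a)
  valency-nonZero a with nonempty a
  ... | x , y , xay = ℕ.>-nonZero
    (positive (λ i → rel a x (element X i)) (Inverse.from (enum X) y)
      (subst (λ z → x ⟨ a ⟩ z) (sym (Inverse.strictlyInverseˡ (enum X) y)) xay))
    where
    positive : ∀ {n} (f : Fin n → Bool) i → T (f i) → 0 ℕ.< ∣ tabulate f ∣
    positive f Fin.zero t with true ← f Fin.zero = ℕ.s≤s ℕ.z≤n
    positive f (Fin.suc i) t = ℕ.≤-trans (positive (λ j → f (Fin.suc j)) i t)
      (Subset.∣p∣≤∣x∷p∣ (f Fin.zero) (tabulate λ j → f (Fin.suc j)))

-- The underlying data of a dagger Frobenius structure; the comultiplication and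
-- counit are mult † and unit †.
record FrobeniusData : Set₁ where
  field
    object : FinSet
    mult   : Matrix (object ⊗ object) object
    unit   : Matrix I object

mult-entry : ∀ {X} (C : CoherentConfiguration X) →
  let open CoherentConfiguration C in (a b c : Carrier S) → ℝ≥0
mult-entry C a b c = √ (ratio (valency c) (valency a ℕ.* valency b)) * fromℕ (∇ a b c)
  where
  open CoherentConfiguration C
  instance
    nz : NonZero (valency a ℕ.* valency b)
    nz = ℕ.m*n≢0 (valency a) (valency b)
           {{valency-nonZero a}} {{valency-nonZero b}}

frobenius : ∀ {X} → CoherentConfiguration X → FrobeniusData
frobenius C = record
  { object = S
  ; mult   = matrix λ (a , b) c → mult-entry C a b c
  ; unit   = matrix λ _ a → if does (⊆id? a) then fromℕ 1 else fromℕ 0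
  }
  where open CoherentConfiguration C

valencyVector : ∀ {X} (C : CoherentConfiguration X) →
                Matrix I (CoherentConfiguration.S C)
valencyVector C = matrix λ _ a → √ (fromℕ (CoherentConfiguration.valency C a))

{-# OPTIONS --safe #-}

-- Write k for the valencies.  The factors √k_b √(k_b/(k_p k_q)) √(k_a/(k_p k_q))
-- collapse to √k_a k_b/(k_p k_q), so the a-th entry of M ∘ v is
--   √k_a ∑_{p,q} ∇_pq^a/(k_p k_q) ∑_b k_b ∇_pq^b.
-- Fix x in the source of p.  Counting pairs (z , y) with
-- (x , z) ∈ p and (z , y) ∈ q according to the relation b of (x , y) gives
-- ∑_b k_b ∇_pq^b = k_p k_q whenever p and q are composable, in particular whenever
-- ∇_pq^a ≠ 0.  What remains is √k_a ∑_{p,q} ∇_pq^a = √k_a n, because each point z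
-- lies on exactly one path p q between two given points.

module Submission where

open import Defs
open import Algebra.Bundles using (CommutativeSemiring)
open import Data.Bool using (Bool; true; false; T; if_then_else_; _∧_)
import Data.Bool.Properties as Bool
open import Data.Fin as Fin using (Fin)
import Data.Fin.Properties as Fin
open import Data.Fin.Subset using (∣_∣)
open import Data.Integer as ℤ using (+_)
import Data.Integer.Properties as ℤ
open import Data.Nat as ℕ using (ℕ; zero; suc; NonZero)
import Data.Nat.Properties as ℕ
open import Data.Product using (∃; _×_; _,_)
open import Data.Rational as ℚ using (ℚ; 0ℚ; 1ℚ; ½)
import Data.Rational.Properties as ℚ
open import Data.Rational.Solver using (module +-*-Solver)
open import Data.Rational.Unnormalised as ℚᵘ using (mkℚᵘ)
import Data.Rational.Unnormalised.Properties as ℚᵘ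
open import Data.Unit using (tt)
open import Data.Vec using (tabulate)
open import Function.Bundles using (Inverse; Equivalence)
open import Level using (0ℓ)
open import Relation.Binary.PropositionalEquality as ≡
  using (_≡_; refl; cong; cong₂; subst; subst₂)
open import Relation.Binary.Structures using (IsEquivalence)
open import Relation.Nullary using (¬_; contradiction)
import Algebra.Properties.Semiring.Sum ℕ.+-*-semiring as ℕΣ

-- The semiring of non-negative reals

Eventually : (ℕ → Set) → Set
Eventually P = ∃ λ N → ∀ k → N ℕ.≤ k → P k

zipEventually : ∀ {P Q R : ℕ → Set} → (∀ k → P k → Q k → R k) →
                Eventually P → Eventually Q → Eventually R
zipEventually f (N , p) (M , q) = N ℕ.⊔ M , λ k N⊔M≤k →
  f k (p k (ℕ.m⊔n≤o⇒m≤o N M N⊔M≤k)) (q k (ℕ.m⊔n≤o⇒n≤o N M N⊔M≤k))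

infix 4 _≲_

-- The asymptotic order, one half of `_≈_`. A single monotonicity estimate, used in both directions
-- with `≲-antisym`, then gives a congruence for `_≈_`.
_≲_ : ℝ≥0 → ℝ≥0 → Set
x ≲ y = ∀ ε → 0ℚ ℚ.< ε → Eventually λ k → seq x k ℚ.≤ seq y k ℚ.+ ε

≈⇒≲ : ∀ x y → x ≈ y → x ≲ y
≈⇒≲ x y x≈y ε 0<ε = let N , h = x≈y ε 0<ε in
  N , λ k N≤k → near⇒≤ (seq x k) (seq y k) (h k N≤k)

≲-antisym : ∀ x y → x ≲ y → y ≲ x → x ≈ y
≲-antisym x y x≲y y≲x ε 0<ε =
  zipEventually (λ k → ≤⇒near (seq x k) (seq y k)) (x≲y ε 0<ε) (y≲x ε 0<ε)

≤⇒≲ : ∀ x y → (∀ k → seq x k ℚ.≤ seq y k) → x ≲ y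
≤⇒≲ x y x≤y ε 0<ε = 0 , λ k _ → ℚ.≤-trans (x≤y k)
  (ℚ.≤-trans (ℚ.≤-reflexive (≡.sym (ℚ.+-identityʳ _)))
             (ℚ.+-monoʳ-≤ (seq y k) (ℚ.<⇒≤ 0<ε)))

-- Addition and multiplication act termwise on approximating sequences, so this reduces the
-- algebraic laws of the reals to those of ℚ at each index.
≡⇒≈ : ∀ x y → (∀ k → seq x k ≡ seq y k) → x ≈ y
≡⇒≈ x y x≡y = ≲-antisym x y (≤⇒≲ x y λ k → ℚ.≤-reflexive (x≡y k))
                            (≤⇒≲ y x λ k → ℚ.≤-reflexive (≡.sym (x≡y k)))

≲-trans : ∀ x y z → x ≲ y → y ≲ z → x ≲ z
≲-trans x y z x≲y y≲z ε 0<ε = zipEventually (λ k x≤ y≤ → begin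
  seq x k                                ≤⟨ x≤ ⟩
  seq y k ℚ.+ ½ ℚ.* ε                    ≤⟨ ℚ.+-monoˡ-≤ (½ ℚ.* ε) y≤ ⟩
  seq z k ℚ.+ ½ ℚ.* ε ℚ.+ ½ ℚ.* ε        ≡⟨ ℚ.+-assoc (seq z k) _ _ ⟩
  seq z k ℚ.+ (½ ℚ.* ε ℚ.+ ½ ℚ.* ε)      ≡⟨ cong (seq z k ℚ.+_) (halves ε) ⟩
  seq z k ℚ.+ ε                          ∎)
  (x≲y (½ ℚ.* ε) (half-pos 0<ε)) (y≲z (½ ℚ.* ε) (half-pos 0<ε))
  where open ℚ.≤-Reasoning

≈-isEquivalence : IsEquivalence _≈_
≈-isEquivalence = record
  { refl  = λ {x} → ≡⇒≈ x x λ _ → refl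
  ; sym   = λ {x} {y} x≈y → ≲-antisym y x (≳ x y x≈y) (≈⇒≲ x y x≈y)
  ; trans = λ {x} {y} {z} x≈y y≈z → ≲-antisym x z
      (≲-trans x y z (≈⇒≲ x y x≈y) (≈⇒≲ y z y≈z))
      (≲-trans z y x (≳ y z y≈z) (≳ x y x≈y))
  }
  where
  ≳ : ∀ x y → x ≈ y → y ≲ x
  ≳ x y x≈y ε 0<ε = let N , h = x≈y ε 0<ε in N , λ k N≤k →
    near⇒≤ (seq y k) (seq x k) (subst (ℚ._≤ ε) (∣-∣-sym (seq x k) (seq y k)) (h k N≤k))
    where
    ∣-∣-sym : ∀ p q → ℚ.∣ p ℚ.- q ∣ ≡ ℚ.∣ q ℚ.- p ∣
    ∣-∣-sym p q = ≡.trans (≡.sym (ℚ.∣-p∣≡∣p∣ (p ℚ.- q)))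
      (cong ℚ.∣_∣ (solve 2 (λ p q → :- (p :- q) := q :- p) refl p q))
      where open +-*-Solver

open IsEquivalence ≈-isEquivalence using ()
  renaming (refl to ≈-refl; sym to ≈-sym; trans to ≈-trans)

+-monoˡ-≲ : ∀ x x′ y → x ≲ x′ → x + y ≲ x′ + y
+-monoˡ-≲ x x′ y x≲x′ ε 0<ε = let N , h = x≲x′ ε 0<ε in N , λ k N≤k → begin
  seq (x + y) k                     ≡⟨ seq-+ x y k ⟩
  seq x k ℚ.+ seq y k               ≤⟨ ℚ.+-monoˡ-≤ (seq y k) (h k N≤k) ⟩
  seq x′ k ℚ.+ ε ℚ.+ seq y k        ≡⟨ solve 3 (λ a e b → a :+ e :+ b := a :+ b :+ e)
                                         refl (seq x′ k) ε (seq y k) ⟩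
  seq x′ k ℚ.+ seq y k ℚ.+ ε        ≡⟨ cong (ℚ._+ ε) (seq-+ x′ y k) ⟨
  seq (x′ + y) k ℚ.+ ε              ∎
  where open ℚ.≤-Reasoning
        open +-*-Solver

-- The factor `y` is eventually at most some `B > 0`, so an error of `δ = ε / B` in `x` grows to at
-- most `ε` in the product.
*-monoˡ-≲ : ∀ x x′ y → x ≲ x′ → x * y ≲ x′ * y
*-monoˡ-≲ x x′ y x≲x′ ε 0<ε =
  let N , B , 0<B , y≤B = bounded y
      δ , 0<δ , Bδ≡ε    = divide 0<B 0<ε
  in zipEventually (λ k → step k B δ 0<δ Bδ≡ε) (N , y≤B) (x≲x′ δ 0<δ)
  where
  open ℚ.≤-Reasoning
  step : ∀ k B δ → 0ℚ ℚ.< δ → B ℚ.* δ ≡ ε → seq y k ℚ.≤ B →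
         seq x k ℚ.≤ seq x′ k ℚ.+ δ → seq (x * y) k ℚ.≤ seq (x′ * y) k ℚ.+ ε
  step k B δ 0<δ Bδ≡ε y≤B x≤ = begin
    seq (x * y) k
      ≡⟨ seq-* x y k ⟩
    seq x k ℚ.* seq y k
      ≤⟨ ℚ.*-monoʳ-≤-nonNeg (seq y k) {{ℚ.nonNegative (0≤seq y k)}} x≤ ⟩
    (seq x′ k ℚ.+ δ) ℚ.* seq y k
      ≡⟨ solve 3 (λ a d b → (a :+ d) :* b := a :* b :+ b :* d)
           refl (seq x′ k) δ (seq y k) ⟩
    seq x′ k ℚ.* seq y k ℚ.+ seq y k ℚ.* δ
      ≤⟨ ℚ.+-monoʳ-≤ (seq x′ k ℚ.* seq y k)
           (ℚ.*-monoʳ-≤-nonNeg δ {{ℚ.nonNegative (ℚ.<⇒≤ 0<δ)}} y≤B) ⟩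
    seq x′ k ℚ.* seq y k ℚ.+ B ℚ.* δ
      ≡⟨ cong₂ ℚ._+_ (≡.sym (seq-* x′ y k)) Bδ≡ε ⟩
    seq (x′ * y) k ℚ.+ ε ∎
    where open +-*-Solver

+-comm : ∀ x y → x + y ≈ y + x
+-comm x y = ≡⇒≈ (x + y) (y + x) λ k → ≡.trans (seq-+ x y k)
  (≡.trans (ℚ.+-comm (seq x k) (seq y k)) (≡.sym (seq-+ y x k)))

*-comm : ∀ x y → x * y ≈ y * x
*-comm x y = ≡⇒≈ (x * y) (y * x) λ k → ≡.trans (seq-* x y k)
  (≡.trans (ℚ.*-comm (seq x k) (seq y k)) (≡.sym (seq-* y x k)))

+-assoc : ∀ x y z → x + y + z ≈ x + (y + z)
+-assoc x y z = ≡⇒≈ (x + y + z) (x + (y + z)) λ k → begin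
  seq (x + y + z) k                     ≡⟨ seq-+ (x + y) z k ⟩
  seq (x + y) k ℚ.+ seq z k             ≡⟨ cong (ℚ._+ seq z k) (seq-+ x y k) ⟩
  seq x k ℚ.+ seq y k ℚ.+ seq z k       ≡⟨ ℚ.+-assoc (seq x k) (seq y k) (seq z k) ⟩
  seq x k ℚ.+ (seq y k ℚ.+ seq z k)     ≡⟨ cong (seq x k ℚ.+_) (seq-+ y z k) ⟨
  seq x k ℚ.+ seq (y + z) k             ≡⟨ seq-+ x (y + z) k ⟨
  seq (x + (y + z)) k                   ∎
  where open ≡.≡-Reasoning

*-assoc : ∀ x y z → x * y * z ≈ x * (y * z)
*-assoc x y z = ≡⇒≈ (x * y * z) (x * (y * z)) λ k → begin
  seq (x * y * z) k                     ≡⟨ seq-* (x * y) z k ⟩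
  seq (x * y) k ℚ.* seq z k             ≡⟨ cong (ℚ._* seq z k) (seq-* x y k) ⟩
  seq x k ℚ.* seq y k ℚ.* seq z k       ≡⟨ ℚ.*-assoc (seq x k) (seq y k) (seq z k) ⟩
  seq x k ℚ.* (seq y k ℚ.* seq z k)     ≡⟨ cong (seq x k ℚ.*_) (seq-* y z k) ⟨
  seq x k ℚ.* seq (y * z) k             ≡⟨ seq-* x (y * z) k ⟨
  seq (x * (y * z)) k                   ∎
  where open ≡.≡-Reasoning

*-distribʳ-+ : ∀ z x y → (x + y) * z ≈ x * z + y * z
*-distribʳ-+ z x y = ≡⇒≈ ((x + y) * z) (x * z + y * z) λ k → begin
  seq ((x + y) * z) k                              ≡⟨ seq-* (x + y) z k ⟩
  seq (x + y) k ℚ.* seq z k                        ≡⟨ cong (ℚ._* seq z k) (seq-+ x y k) ⟩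
  (seq x k ℚ.+ seq y k) ℚ.* seq z k                ≡⟨ ℚ.*-distribʳ-+ (seq z k) (seq x k) (seq y k) ⟩
  seq x k ℚ.* seq z k ℚ.+ seq y k ℚ.* seq z k      ≡⟨ cong₂ ℚ._+_ (seq-* x z k) (seq-* y z k) ⟨
  seq (x * z) k ℚ.+ seq (y * z) k                  ≡⟨ seq-+ (x * z) (y * z) k ⟨
  seq (x * z + y * z) k                            ∎
  where open ≡.≡-Reasoning

+-identityˡ : ∀ x → fromℕ 0 + x ≈ x
+-identityˡ x = ≡⇒≈ (fromℕ 0 + x) x λ k → ≡.trans (seq-+ (fromℕ 0) x k)
  (≡.trans (cong (ℚ._+ seq x k) (seq-fromℚ _ _ k)) (ℚ.+-identityˡ (seq x k)))

*-identityˡ : ∀ x → fromℕ 1 * x ≈ x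
*-identityˡ x = ≡⇒≈ (fromℕ 1 * x) x λ k → ≡.trans (seq-* (fromℕ 1) x k)
  (≡.trans (cong (ℚ._* seq x k) (seq-fromℚ _ _ k)) (ℚ.*-identityˡ (seq x k)))

*-zeroˡ : ∀ x → fromℕ 0 * x ≈ fromℕ 0
*-zeroˡ x = ≡⇒≈ (fromℕ 0 * x) (fromℕ 0) λ k → ≡.trans (seq-* (fromℕ 0) x k)
  (≡.trans (cong (ℚ._* seq x k) (seq-fromℚ _ _ k))
  (≡.trans (ℚ.*-zeroˡ (seq x k)) (≡.sym (seq-fromℚ _ _ k))))

+-congʳ : ∀ x x′ y → x ≈ x′ → x + y ≈ x′ + y
+-congʳ x x′ y x≈x′ = ≲-antisym (x + y) (x′ + y)
  (+-monoˡ-≲ x x′ y (≈⇒≲ x x′ x≈x′))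
  (+-monoˡ-≲ x′ x y (≈⇒≲ x′ x (≈-sym {x} {x′} x≈x′)))

*-congʳ : ∀ x x′ y → x ≈ x′ → x * y ≈ x′ * y
*-congʳ x x′ y x≈x′ = ≲-antisym (x * y) (x′ * y)
  (*-monoˡ-≲ x x′ y (≈⇒≲ x x′ x≈x′))
  (*-monoˡ-≲ x′ x y (≈⇒≲ x′ x (≈-sym {x} {x′} x≈x′)))

-- _≈_ unfolds to a function type, from which its arguments cannot be inferred.
infix 4 _≋_

record _≋_ (x y : ℝ≥0) : Set where
  constructor ⌊_⌋
  field ⌈_⌉ : x ≈ y
open _≋_

ℝ≥0-commutativeSemiring : CommutativeSemiring 0ℓ 0ℓ
ℝ≥0-commutativeSemiring = record
  { Carrier = ℝ≥0
  ; _≈_ = _≋_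
  ; _+_ = _+_
  ; _*_ = _*_
  ; 0# = fromℕ 0
  ; 1# = fromℕ 1
  ; isCommutativeSemiring = isCommutativeSemiringˡ record
    { +-isCommutativeMonoid = commutativeMonoid
        (λ x y → ⌊ +-comm x y ⌋) (λ {x} {x′} y x≋x′ → ⌊ +-congʳ x x′ y ⌈ x≋x′ ⌉ ⌋)
        (λ x y z → ⌊ +-assoc x y z ⌋) (λ x → ⌊ +-identityˡ x ⌋)
    ; *-isCommutativeMonoid = commutativeMonoid
        (λ x y → ⌊ *-comm x y ⌋) (λ {x} {x′} y x≋x′ → ⌊ *-congʳ x x′ y ⌈ x≋x′ ⌉ ⌋)
        (λ x y z → ⌊ *-assoc x y z ⌋) (λ x → ⌊ *-identityˡ x ⌋)
    ; distribʳ = λ z x y → ⌊ *-distribʳ-+ z x y ⌋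
    ; zeroˡ = λ x → ⌊ *-zeroˡ x ⌋
    }
  }
  where
  open import Algebra.Structures _≋_ using (IsCommutativeMonoid)
  open import Algebra.Structures.Biased _≋_
    using (isCommutativeMonoidˡ; isCommutativeSemiringˡ)
  open import Algebra.Definitions _≋_ using (Associative; Commutative; LeftIdentity)
  ≋-isEquivalence : IsEquivalence _≋_
  ≋-isEquivalence = record
    { refl  = λ {x} → ⌊ ≈-refl {x} ⌋
    ; sym   = λ {x} {y} x≋y → ⌊ ≈-sym {x} {y} ⌈ x≋y ⌉ ⌋
    ; trans = λ {x} {y} {z} x≋y y≋z → ⌊ ≈-trans {x} {y} {z} ⌈ x≋y ⌉ ⌈ y≋z ⌉ ⌋
    }
  open IsEquivalence ≋-isEquivalence using (trans)
  -- Commutativity carries congruence in the left argument over to the right one, so one side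
  -- suffices for each operation.
  commutativeMonoid : ∀ {_∙_ e} → Commutative _∙_ →
    (∀ {x x′} y → x ≋ x′ → (x ∙ y) ≋ (x′ ∙ y)) →
    Associative _∙_ → LeftIdentity e _∙_ → IsCommutativeMonoid _∙_ e
  commutativeMonoid comm congʳ assoc identityˡ = isCommutativeMonoidˡ record
    { isSemigroup = record
      { isMagma = record
        { isEquivalence = ≋-isEquivalence
        ; ∙-cong = λ {x} {x′} {y} {y′} x≋x′ y≋y′ →
            trans (congʳ y x≋x′) (trans (comm x′ y) (trans (congʳ x′ y≋y′) (comm y′ x′)))
        }
      ; assoc = assoc
      }
    ; identityˡ = identityˡ
    ; comm = comm
    }

-- Square roots of non-negative reals

-- If `p` exceeded `q + ε`, then `p²` would exceed `(q + ε)²`, which is at least `q² + ε²` because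
-- the cross terms are non-negative.
square-cancel-≤ : ∀ {p q ε} → 0ℚ ℚ.≤ q → 0ℚ ℚ.< ε →
  p ℚ.* p ℚ.≤ q ℚ.* q ℚ.+ ε ℚ.* ε → p ℚ.≤ q ℚ.+ ε
square-cancel-≤ {p} {q} {ε} 0≤q 0<ε p²≤ = ℚ.≮⇒≥ λ q+ε<p →
  ℚ.<-irrefl refl (begin-strict
    q ℚ.* q ℚ.+ ε ℚ.* ε
      ≡⟨ ℚ.+-identityʳ _ ⟨
    q ℚ.* q ℚ.+ ε ℚ.* ε ℚ.+ 0ℚ
      ≤⟨ ℚ.+-monoʳ-≤ (q ℚ.* q ℚ.+ ε ℚ.* ε) (0≤+ (0≤* 0≤q (ℚ.<⇒≤ 0<ε)) (0≤* 0≤q (ℚ.<⇒≤ 0<ε))) ⟩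
    q ℚ.* q ℚ.+ ε ℚ.* ε ℚ.+ (q ℚ.* ε ℚ.+ q ℚ.* ε)
      ≡⟨ solve 2 (λ q e → q :* q :+ e :* e :+ (q :* e :+ q :* e)
                       := (q :+ e) :* (q :+ e)) refl q ε ⟩
    (q ℚ.+ ε) ℚ.* (q ℚ.+ ε)
      <⟨ ℚ.*-monoʳ-<-pos (q ℚ.+ ε) {{ℚ.positive 0<q+ε}} q+ε<p ⟩
    (q ℚ.+ ε) ℚ.* p
      <⟨ ℚ.*-monoˡ-<-pos p {{ℚ.positive (ℚ.<-trans 0<q+ε q+ε<p)}} q+ε<p ⟩
    p ℚ.* p
      ≤⟨ p²≤ ⟩
    q ℚ.* q ℚ.+ ε ℚ.* ε ∎)
  where
  open ℚ.≤-Reasoning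
  open +-*-Solver
  0<q+ε : 0ℚ ℚ.< q ℚ.+ ε
  0<q+ε = ℚ.+-mono-≤-< 0≤q 0<ε

square-cancel-≲ : ∀ x y → x * x ≲ y * y → x ≲ y
square-cancel-≲ x y x²≲y² ε 0<ε =
  -- Tolerance `ε²` between the squares becomes tolerance `ε` between the numbers themselves.
  let N , h = x²≲y² (ε ℚ.* ε)
        (ℚ.positive⁻¹ _ {{ℚ.pos*pos⇒pos ε {{ℚ.positive 0<ε}} ε {{ℚ.positive 0<ε}}}})
  in N , λ k N≤k → square-cancel-≤ (0≤seq y k) 0<ε
       (subst₂ (λ a b → a ℚ.≤ b ℚ.+ ε ℚ.* ε) (seq-* x x k) (seq-* y y k) (h k N≤k))

square-cancel : ∀ x y → x * x ≈ y * y → x ≈ y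
square-cancel x y x²≈y² = ≲-antisym x y
  (square-cancel-≲ x y (≈⇒≲ (x * x) (y * y) x²≈y²))
  (square-cancel-≲ y x (≈⇒≲ (y * y) (x * x) (≈-sym {x * x} {y * y} x²≈y²)))

-- `√-approx` rounds down, so its square is at most `seq x k` at every index. Only the opposite
-- inequality costs an error, controlled by the mesh.
√-square : ∀ x → √ x * √ x ≈ x
√-square x = ≲-antisym (√ x * √ x) x
  (≤⇒≲ (√ x * √ x) x λ k → subst (ℚ._≤ seq x k) (≡.sym (√²≡ k))
    (√-approx-≤ k (seq x k) (0≤seq x k)))
  lower
  where
  √²≡ : ∀ k → seq (√ x * √ x) k ≡ √-approx k (seq x k) ℚ.* √-approx k (seq x k)
  √²≡ k = ≡.trans (seq-* (√ x) (√ x) k) (cong (λ s → s ℚ.* s) (seq-√ x k))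
  -- (s + g)² − s² = g (2 s + g), where s is eventually bounded and g ≤ 1.
  lower : x ≲ √ x * √ x
  lower ε 0<ε =
    let N , B , 0<B , s≤B = bounded (√ x)
        δ , 0<δ , Cδ≡ε = divide (ℚ.+-mono-< (ℚ.+-mono-< 0<B 0<B) (ℚ.positive⁻¹ 1ℚ)) 0<ε
    in zipEventually (λ k → step k B δ 0<δ Cδ≡ε) (N , s≤B) (√-mesh-small δ 0<δ)
    where
    open ℚ.≤-Reasoning
    open +-*-Solver
    step : ∀ k B δ → 0ℚ ℚ.< δ → (B ℚ.+ B ℚ.+ 1ℚ) ℚ.* δ ≡ ε → seq (√ x) k ℚ.≤ B →
           √-mesh k ℚ.≤ δ → seq x k ℚ.≤ seq (√ x * √ x) k ℚ.+ ε
    step k B δ 0<δ Cδ≡ε s≤B′ g≤δ = begin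
      seq x k
        <⟨ √-approx-> k (seq x k) (0≤seq x k) ⟩
      (s ℚ.+ g) ℚ.* (s ℚ.+ g)
        ≡⟨ solve 2 (λ s g → (s :+ g) :* (s :+ g) := s :* s :+ (s :+ s :+ g) :* g) refl s g ⟩
      s ℚ.* s ℚ.+ (s ℚ.+ s ℚ.+ g) ℚ.* g
        ≤⟨ ℚ.+-monoʳ-≤ (s ℚ.* s) (ℚ-*-mono-≤ {s ℚ.+ s ℚ.+ g} (0≤+ (0≤+ 0≤s 0≤s) 0≤g) (ℚ.<⇒≤ 0<δ)
             (ℚ.+-mono-≤ (ℚ.+-mono-≤ s≤B s≤B) g≤1) g≤δ) ⟩
      s ℚ.* s ℚ.+ (B ℚ.+ B ℚ.+ 1ℚ) ℚ.* δ
        ≡⟨ cong₂ ℚ._+_ (≡.sym (√²≡ k)) Cδ≡ε ⟩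
      seq (√ x * √ x) k ℚ.+ ε ∎
      where
      s = √-approx k (seq x k)
      g = √-mesh k
      0≤s : 0ℚ ℚ.≤ s
      0≤s = 0≤/ (√-num k (seq x k)) (suc k)
      0≤g : 0ℚ ℚ.≤ g
      0≤g = 0≤/ 1 (suc k)
      s≤B : s ℚ.≤ B
      s≤B = subst (ℚ._≤ B) (seq-√ x k) s≤B′
      g≤1 : g ℚ.≤ 1ℚ
      g≤1 = frac-≤ 1 k 1 0 (ℕ.s≤s ℕ.z≤n)

open CommutativeSemiring ℝ≥0-commutativeSemiring
  using (semiring; setoid; *-commutativeMonoid; +-congˡ; *-cong; *-congˡ; *-identityʳ; zeroˡ)
  renaming (refl to ≋-refl; sym to ≋-sym; trans to ≋-trans; reflexive to ≋-reflexive;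
            *-congʳ to ≋-congʳ)
import Algebra.Properties.Semiring.Sum semiring as ℝΣ
open import Algebra.Solver.CommutativeMonoid *-commutativeMonoid using (solve; _⊕_; _⊜_)
import Relation.Binary.Reasoning.Setoid setoid as ≋-Reasoning

-- Natural numbers and fractions

frac-≡ : ∀ a c b d → a ℕ.* suc d ≡ b ℕ.* suc c → frac a c ≡ frac b d
frac-≡ a c b d eq = ℚ.≤-antisym (frac-≤ a c b d (ℕ.≤-reflexive eq))
                                (frac-≤ b d a c (ℕ.≤-reflexive (≡.sym eq)))

-- Since `frac a c` stands for `a / (c + 1)`, the index `d + c * suc d` is the predecessor of the
-- product of the two denominators.
frac-* : ∀ a c b d → frac a c ℚ.* frac b d ≡ frac (a ℕ.* b) (d ℕ.+ c ℕ.* suc d)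
frac-* a c b d = ℚ.toℚᵘ-injective (begin
  ℚ.toℚᵘ (frac a c ℚ.* frac b d)
    ≈⟨ ℚ.toℚᵘ-homo-* (frac a c) (frac b d) ⟩
  ℚ.toℚᵘ (frac a c) ℚᵘ.* ℚ.toℚᵘ (frac b d)
    ≈⟨ ℚᵘ.*-cong (toℚᵘ-frac a c) (toℚᵘ-frac b d) ⟩
  mkℚᵘ (+ a ℤ.* + b) (d ℕ.+ c ℕ.* suc d)
    ≡⟨ cong (λ n → mkℚᵘ n (d ℕ.+ c ℕ.* suc d)) (≡.sym (ℤ.pos-* a b)) ⟩
  mkℚᵘ (+ (a ℕ.* b)) (d ℕ.+ c ℕ.* suc d)
    ≈⟨ toℚᵘ-frac (a ℕ.* b) (d ℕ.+ c ℕ.* suc d) ⟨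
  ℚ.toℚᵘ (frac (a ℕ.* b) (d ℕ.+ c ℕ.* suc d)) ∎)
  where open ℚᵘ.≃-Reasoning

frac-+ : ∀ a b → frac a 0 ℚ.+ frac b 0 ≡ frac (a ℕ.+ b) 0
frac-+ a b = ℚ.toℚᵘ-injective (begin
  ℚ.toℚᵘ (frac a 0 ℚ.+ frac b 0)
    ≈⟨ ℚ.toℚᵘ-homo-+ (frac a 0) (frac b 0) ⟩
  ℚ.toℚᵘ (frac a 0) ℚᵘ.+ ℚ.toℚᵘ (frac b 0)
    ≈⟨ ℚᵘ.+-cong (toℚᵘ-frac a 0) (toℚᵘ-frac b 0) ⟩
  mkℚᵘ (+ a ℤ.* + 1 ℤ.+ + b ℤ.* + 1) 0
    ≡⟨ cong₂ (λ m n → mkℚᵘ (m ℤ.+ n) 0) (ℤ.*-identityʳ (+ a)) (ℤ.*-identityʳ (+ b)) ⟩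
  mkℚᵘ (+ (a ℕ.+ b)) 0
    ≈⟨ toℚᵘ-frac (a ℕ.+ b) 0 ⟨
  ℚ.toℚᵘ (frac (a ℕ.+ b) 0) ∎)
  where open ℚᵘ.≃-Reasoning

-- Finite sums and counting

𝟙 : Bool → ℕ
𝟙 b = if b then 1 else 0

𝟙-∧ : ∀ b c → 𝟙 (b ∧ c) ≡ 𝟙 b ℕ.* 𝟙 c
𝟙-∧ true  c = ≡.sym (ℕ.*-identityˡ (𝟙 c))
𝟙-∧ false c = refl

-- Counts become sums of indicators, so that double counting becomes an exchange of sums.
∣tabulate∣≡sum : ∀ {n} (f : Fin n → Bool) → ∣ tabulate f ∣ ≡ ℕΣ.sum (λ i → 𝟙 (f i))
∣tabulate∣≡sum {zero}  f = refl
∣tabulate∣≡sum {suc n} f with f Fin.zero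
... | true  = cong suc (∣tabulate∣≡sum (λ i → f (Fin.suc i)))
... | false = ∣tabulate∣≡sum (λ i → f (Fin.suc i))

∑ℕ : (A : FinSet) → (Carrier A → ℕ) → ℕ
∑ℕ A f = ℕΣ.sum (λ i → f (element A i))

module _ (A : FinSet) where

  index : Carrier A → Fin (card A)
  index = Inverse.from (enum A)

  element-index : ∀ z → element A (index z) ≡ z
  element-index = Inverse.strictlyInverseˡ (enum A)

  count≡∑ : (P : Carrier A → Bool) → count A P ≡ ∑ℕ A (λ z → 𝟙 (P z))
  count≡∑ P = ∣tabulate∣≡sum (λ i → P (element A i))

  ∑ℕ-cong : ∀ {f g} → (∀ z → f z ≡ g z) → ∑ℕ A f ≡ ∑ℕ A g
  ∑ℕ-cong f≡g = ℕΣ.sum-cong-≗ (λ i → f≡g (element A i))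

  ∑ℕ-1 : ∑ℕ A (λ _ → 1) ≡ card A
  ∑ℕ-1 = go (card A)
    where
    go : ∀ n → ℕΣ.sum {n} (λ _ → 1) ≡ n
    go zero    = refl
    go (suc n) = cong suc (go n)

  -- Positivity is phrased as `≡ suc m` so that the equation from a case split on a count can be
  -- used directly.
  count-witness : ∀ {m} (P : Carrier A → Bool) → count A P ≡ suc m → ∃ λ z → T (P z)
  count-witness P eq =
    let i , t = go (λ i → P (element A i)) (≡.trans (≡.sym (count≡∑ P)) eq) in element A i , t
    where
    go : ∀ {n m} (f : Fin n → Bool) → ℕΣ.sum (λ i → 𝟙 (f i)) ≡ suc m → ∃ λ i → T (f i)
    go {suc n} f eq with f Fin.zero in f0
    ... | true  = Fin.zero , subst T (≡.sym f0) _
    ... | false = let i , t = go (λ i → f (Fin.suc i)) eq in Fin.suc i , t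

  count-nonZero : (P : Carrier A → Bool) → ∀ {z} → T (P z) → ∃ λ m → count A P ≡ suc m
  count-nonZero P {z} t =
    let m , eq = go (λ i → P (element A i)) (index z)
                    (subst (λ w → T (P w)) (≡.sym (element-index z)) t)
    in m , ≡.trans (count≡∑ P) eq
    where
    go : ∀ {n} (f : Fin n → Bool) i → T (f i) → ∃ λ m → ℕΣ.sum (λ i → 𝟙 (f i)) ≡ suc m
    go f Fin.zero    t with true ← f Fin.zero = _ , refl
    go f (Fin.suc i) t with go (λ i → f (Fin.suc i)) i t
    ... | m , eq = _ , ≡.trans (cong (𝟙 (f Fin.zero) ℕ.+_) eq) (ℕ.+-suc _ m)

  -- The enumeration is a bijection, so uniqueness among elements is uniqueness among indices, and
  -- exactly one indicator in the sum equals 1.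
  count-unique : (P : Carrier A → Bool) → ∀ {z} → T (P z) → (∀ {w} → T (P w) → z ≡ w) →
                 count A P ≡ 1
  count-unique P {z} t unique = ≡.trans (count≡∑ P)
    (go (λ i → P (element A i)) (index z)
        (subst (λ w → T (P w)) (≡.sym (element-index z)) t)
        (λ j t → ≡.trans (cong index (unique t)) (Inverse.strictlyInverseʳ (enum A) j)))
    where
    none : ∀ {n} (f : Fin n → Bool) → (∀ i → ¬ T (f i)) → ℕΣ.sum (λ i → 𝟙 (f i)) ≡ 0
    none {zero}  f ¬f = refl
    none {suc n} f ¬f with f Fin.zero in f0
    ... | true  = contradiction (subst T (≡.sym f0) _) (¬f Fin.zero)
    ... | false = none (λ i → f (Fin.suc i)) (λ i → ¬f (Fin.suc i))

    go : ∀ {n} (f : Fin n → Bool) i → T (f i) → (∀ j → T (f j) → i ≡ j) →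
         ℕΣ.sum (λ i → 𝟙 (f i)) ≡ 1
    go f Fin.zero t uniq with true ← f Fin.zero =
      cong suc (none (λ i → f (Fin.suc i)) (λ i t → contradiction (uniq (Fin.suc i) t) λ ()))
    go f (Fin.suc i) t uniq with f Fin.zero in f0
    ... | true  = contradiction (uniq Fin.zero (subst T (≡.sym f0) _)) λ ()
    ... | false = go (λ i → f (Fin.suc i)) i t (λ j t → Fin.suc-injective (uniq (Fin.suc j) t))

-- Sums of reals and the embedding of naturals and fractions

∑-cong : ∀ A {f g : Carrier A → ℝ≥0} → (∀ z → f z ≋ g z) → ∑ A f ≋ ∑ A g
∑-cong A f≋g = ℝΣ.sum-cong-≋ (λ i → f≋g (element A i))

∑-comm : ∀ A B (f : Carrier A → Carrier B → ℝ≥0) →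
         ∑ A (λ a → ∑ B (f a)) ≋ ∑ B (λ b → ∑ A (λ a → f a b))
∑-comm A B f = ℝΣ.∑-comm (λ i j → f (element A i) (element B j))

*-distribˡ-∑ : ∀ A x (f : Carrier A → ℝ≥0) → x * ∑ A f ≋ ∑ A (λ a → x * f a)
*-distribˡ-∑ A x f = ℝΣ.*-distribˡ-sum x (λ i → f (element A i))

fromℕ-+ : ∀ m n → fromℕ (m ℕ.+ n) ≋ fromℕ m + fromℕ n
fromℕ-+ m n = ⌊ ≡⇒≈ (fromℕ (m ℕ.+ n)) (fromℕ m + fromℕ n) (λ k → begin
  seq (fromℕ (m ℕ.+ n)) k               ≡⟨ seq-fromℚ _ _ k ⟩
  frac (m ℕ.+ n) 0                      ≡⟨ frac-+ m n ⟨
  frac m 0 ℚ.+ frac n 0                 ≡⟨ cong₂ ℚ._+_ (seq-fromℚ _ _ k) (seq-fromℚ _ _ k) ⟨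
  seq (fromℕ m) k ℚ.+ seq (fromℕ n) k   ≡⟨ seq-+ (fromℕ m) (fromℕ n) k ⟨
  seq (fromℕ m + fromℕ n) k             ∎) ⌋
  where open ≡.≡-Reasoning

fromℕ-*-ratio : ∀ m n d .{{_ : NonZero d}} → fromℕ m * ratio n d ≋ ratio (m ℕ.* n) d
fromℕ-*-ratio m n (suc d) = ⌊ ≡⇒≈ (fromℕ m * ratio n (suc d)) (ratio (m ℕ.* n) (suc d)) (λ k → begin
  seq (fromℕ m * ratio n (suc d)) k                ≡⟨ seq-* (fromℕ m) (ratio n (suc d)) k ⟩
  seq (fromℕ m) k ℚ.* seq (ratio n (suc d)) k      ≡⟨ cong₂ ℚ._*_ (seq-fromℚ _ _ k) (seq-fromℚ _ _ k) ⟩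
  frac m 0 ℚ.* frac n d                            ≡⟨ frac-* m 0 n d ⟩
  frac (m ℕ.* n) (d ℕ.+ 0)                         ≡⟨ cong (frac (m ℕ.* n)) (ℕ.+-identityʳ d) ⟩
  frac (m ℕ.* n) d                                 ≡⟨ seq-fromℚ _ _ k ⟨
  seq (ratio (m ℕ.* n) (suc d)) k                  ∎) ⌋
  where open ≡.≡-Reasoning

ratio-fromℕ : ∀ m d .{{_ : NonZero d}} → ratio m d ≋ fromℕ m * ratio 1 d
ratio-fromℕ m d = ≋-trans
  (≋-reflexive (cong (λ n → ratio n d) (≡.sym (ℕ.*-identityʳ m))))
  (≋-sym (fromℕ-*-ratio m 1 d))

ratio-inverse : ∀ d .{{_ : NonZero d}} → fromℕ d * ratio 1 d ≋ fromℕ 1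
ratio-inverse d@(suc d-1) = ≋-trans (fromℕ-*-ratio d 1 d)
  ⌊ ≡⇒≈ (ratio (d ℕ.* 1) d) (fromℕ 1) (λ k → ≡.trans (seq-fromℚ _ _ k)
      (≡.trans (frac-≡ (d ℕ.* 1) d-1 1 0 eq) (≡.sym (seq-fromℚ _ _ k)))) ⌋
  where
  eq : d ℕ.* 1 ℕ.* 1 ≡ 1 ℕ.* d
  eq = ≡.trans (ℕ.*-identityʳ _) (ℕ.*-comm d 1)

fromℕ-* : ∀ m n → fromℕ (m ℕ.* n) ≋ fromℕ m * fromℕ n
fromℕ-* m n = ≋-sym (fromℕ-*-ratio m n 1)

fromℕ-∑ : ∀ A f → fromℕ (∑ℕ A f) ≋ ∑ A (λ z → fromℕ (f z))
fromℕ-∑ A f = go (λ i → f (element A i))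
  where
  go : ∀ {n} g → fromℕ (ℕΣ.sum {n} g) ≋ ℝΣ.sum {n} (λ i → fromℕ (g i))
  go {zero}  g = ≋-refl
  go {suc n} g = ≋-trans (fromℕ-+ (g Fin.zero) _) (+-congˡ (go (λ i → g (Fin.suc i))))

fromℕ-suc≉0 : ∀ m → ¬ fromℕ (suc m) ≋ fromℕ 0
fromℕ-suc≉0 m ⌊ eq ⌋ =
  let N , h = ≈⇒≲ (fromℕ (suc m)) (fromℕ 0) eq ½ (ℚ.positive⁻¹ ½)
      sm≤½ = subst₂ (λ a b → a ℚ.≤ b ℚ.+ ½) (seq-fromℚ _ _ N) (seq-fromℚ _ _ N) (h N ℕ.≤-refl)
  -- `frac 1 1` is `½`; tolerance `½` already separates `suc m` from 0.
  in ℚ.<-irrefl refl (ℚ.<-≤-trans (frac-< 1 1 (suc m) 0 (ℕ.s≤s (ℕ.s≤s ℕ.z≤n))) sm≤½)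

-- Both sides square to `m² n / d²`, and non-negative reals with equal squares are equal. It is
-- applied with `m`, `n` the valencies of `b`, `a` and `d` the product of those of `p` and `q`.
√-ratio : ∀ m n d .{{_ : NonZero d}} →
  √ (fromℕ m) * (√ (ratio m d) * √ (ratio n d)) ≋ √ (fromℕ n) * (fromℕ m * ratio 1 d)
√-ratio m n d = ⌊ square-cancel _ _ ⌈ squares ⌉ ⌋
  where
  √² : ∀ x → √ x * √ x ≋ x
  √² x = ⌊ √-square x ⌋
  open ≋-Reasoning
  K = fromℕ m
  L = fromℕ n
  u = ratio 1 d
  a = √ K
  b = √ (ratio m d)
  c = √ (ratio n d)
  e = √ L
  squares : (a * (b * c)) * (a * (b * c)) ≋ (e * (K * u)) * (e * (K * u))
  squares = begin
    (a * (b * c)) * (a * (b * c))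
      ≈⟨ solve 3 (λ a b c → ((a ⊕ (b ⊕ c)) ⊕ (a ⊕ (b ⊕ c))) ⊜ ((a ⊕ a) ⊕ ((b ⊕ b) ⊕ (c ⊕ c))))
           ≋-refl a b c ⟩
    (a * a) * ((b * b) * (c * c))
      ≈⟨ *-cong (√² K) (*-cong (≋-trans (√² _) (ratio-fromℕ m d))
                               (≋-trans (√² _) (ratio-fromℕ n d))) ⟩
    K * ((K * u) * (L * u))
      ≈⟨ solve 3 (λ K L u → (K ⊕ ((K ⊕ u) ⊕ (L ⊕ u))) ⊜ (L ⊕ ((K ⊕ u) ⊕ (K ⊕ u))))
           ≋-refl K L u ⟩
    L * ((K * u) * (K * u))
      ≈⟨ ≋-congʳ (√² L) ⟨
    (e * e) * ((K * u) * (K * u))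
      ≈⟨ solve 2 (λ e w → ((e ⊕ e) ⊕ (w ⊕ w)) ⊜ ((e ⊕ w) ⊕ (e ⊕ w))) ≋-refl e (K * u) ⟩
    (e * (K * u)) * (e * (K * u)) ∎

-- Intersection numbers

module _ {X : FinSet} (C : CoherentConfiguration X) where
  open CoherentConfiguration C

  paths-witness : ∀ {p q x y m} → paths p q x y ≡ suc m → ∃ λ z → x ⟨ p ⟩ z × z ⟨ q ⟩ y
  paths-witness {p} {q} {x} {y} eq =
    let z , t = count-witness X (λ z → rel p x z ∧ rel q z y) eq
    in z , Equivalence.to Bool.T-∧ t

  -- By `regular` the number of `p`, `q` paths is the same over all pairs in `c`, so one path over
  -- `(x , y)` forces one over `(x′ , y′)`.
  paths-transport : ∀ {c p q x y z x′ y′} → x ⟨ c ⟩ y → x′ ⟨ c ⟩ y′ →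
                    x ⟨ p ⟩ z → z ⟨ q ⟩ y → ∃ λ z′ → x′ ⟨ p ⟩ z′ × z′ ⟨ q ⟩ y′
  paths-transport {c} {p} {q} {x} {y} xcy x′cy′ xpz zqy =
    let _ , eq = count-nonZero X (λ z → rel p x z ∧ rel q z y)
                   (Equivalence.from Bool.T-∧ (xpz , zqy))
    in paths-witness (≡.trans (regular p q c x′cy′ xcy) eq)

  -- With `c` the relation of `(y , z)`, the point `y` is the midpoint of a `b`, `c` path over
  -- `(x , z)`. Transporting that path along `p` gives a `b`-successor of `x′`.
  successor-transport : ∀ {p b x z x′ z′ y} → x ⟨ p ⟩ z → x′ ⟨ p ⟩ z′ →
                        x ⟨ b ⟩ y → ∃ λ y′ → x′ ⟨ b ⟩ y′
  successor-transport {z = z} {y = y} xpz x′pz′ xby =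
    let _ , ycz = cover y z
        y′ , x′by′ , _ = paths-transport xpz x′pz′ xby ycz
    in y′ , x′by′

  -- The relation containing (x , x) transports along a to a loop at x′, so the
  -- two counts are the intersection number of a and a⁻¹ at the same relation.
  count-successors : ∀ a {x y} → x ⟨ a ⟩ y → count X (rel a x) ≡ valency a
  count-successors a {x} {y} xay =
    let x′ , y′ , x′ay′ = nonempty a
        a⁻¹ , conv = converse a
        e , xex = cover x x
        w , x′ew = successor-transport xay x′ay′ xex
        x′ex′ = subst (x′ ⟨ e ⟩_) (≡.sym (diagonal xex x′ew)) x′ew
        loops = λ u → ≡.trans (count≡∑ X (rel a u)) (≡.trans
          (∑ℕ-cong X (λ z → cong 𝟙 (absorb (Equivalence.from (conv z u)))))
          (≡.sym (count≡∑ X (λ z → rel a u z ∧ rel a⁻¹ z u))))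
    in ≡.trans (loops x) (≡.trans (regular a a⁻¹ e xex x′ex′) (≡.sym (loops x′)))
    where
    absorb : ∀ {b c} → (T b → T c) → b ≡ b ∧ c
    absorb {true}  {true}  f = refl
    absorb {true}  {false} f = contradiction (f _) λ ()
    absorb {false} {c}     f = refl

  ∑-rel : ∀ x y → ∑ℕ S (λ b → 𝟙 (rel b x y)) ≡ 1
  ∑-rel x y = let b , xby = cover x y in
    ≡.trans (≡.sym (count≡∑ S (λ b → rel b x y))) (count-unique S _ xby (disjoint xby))

  ∑-∇≡card : ∀ c → ∑ℕ (S ⊗ S) (λ (p , q) → ∇ p q c) ≡ card X
  ∑-∇≡card c = let x , y , _ = nonempty c in begin
    ∑ℕ (S ⊗ S) (λ (p , q) → paths p q x y)
      ≡⟨ ∑ℕ-cong (S ⊗ S) (λ (p , q) → count≡∑ X (λ z → rel p x z ∧ rel q z y)) ⟩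
    ∑ℕ (S ⊗ S) (λ (p , q) → ∑ℕ X (λ z → 𝟙 (rel p x z ∧ rel q z y)))
      ≡⟨ ℕΣ.∑-comm {card (S ⊗ S)} {card X} _ ⟩
    ∑ℕ X (λ z → ∑ℕ (S ⊗ S) (λ (p , q) → 𝟙 (rel p x z ∧ rel q z y)))
      ≡⟨ ∑ℕ-cong X (λ z → through x y z) ⟩
    ∑ℕ X (λ _ → 1)
      ≡⟨ ∑ℕ-1 X ⟩
    card X ∎
    where
    open ≡.≡-Reasoning
    -- `cover` supplies the relations of `(x , z)` and `(z , y)`, and `disjoint` makes this pair the
    -- only one.
    through : ∀ x y z → ∑ℕ (S ⊗ S) (λ (p , q) → 𝟙 (rel p x z ∧ rel q z y)) ≡ 1
    through x y z =
      let p , xpz = cover x z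
          q , zqy = cover z y
      in ≡.trans (≡.sym (count≡∑ (S ⊗ S) (λ (p , q) → rel p x z ∧ rel q z y)))
           (count-unique (S ⊗ S) _ {p , q} (Equivalence.from Bool.T-∧ (xpz , zqy))
             λ t → let xp′z , zq′y = Equivalence.to Bool.T-∧ t
                   in cong₂ _,_ (disjoint xpz xp′z) (disjoint zqy zq′y))

  -- If x has no b-successor then both sides vanish: a path p q across b
  -- would transport b to x.
  valency*∇ : ∀ {p q x z} → x ⟨ p ⟩ z → ∀ b →
    valency b ℕ.* ∇ p q b ≡ ∑ℕ X (λ y → 𝟙 (rel b x y) ℕ.* paths p q x y)
  valency*∇ {p} {q} {x} xpz b = begin
    valency b ℕ.* ∇ p q b
      ≡⟨ at-x ⟩
    count X (rel b x) ℕ.* ∇ p q b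
      ≡⟨ cong (ℕ._* ∇ p q b) (count≡∑ X (rel b x)) ⟩
    ∑ℕ X (λ y → 𝟙 (rel b x y)) ℕ.* ∇ p q b
      ≡⟨ ℕΣ.*-distribʳ-sum (∇ p q b) (λ i → 𝟙 (rel b x (element X i))) ⟩
    ∑ℕ X (λ y → 𝟙 (rel b x y) ℕ.* ∇ p q b)
      ≡⟨ ∑ℕ-cong X on-b ⟩
    ∑ℕ X (λ y → 𝟙 (rel b x y) ℕ.* paths p q x y) ∎
    where
    open ≡.≡-Reasoning
    at-x : valency b ℕ.* ∇ p q b ≡ count X (rel b x) ℕ.* ∇ p q b
    at-x with ∇ p q b in eq
    ... | zero  = ≡.trans (ℕ.*-zeroʳ (valency b)) (≡.sym (ℕ.*-zeroʳ (count X (rel b x))))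
    ... | suc m =
      let _ , _ , x₀by₀ = nonempty b
          _ , x₀pz₀ , _ = paths-witness eq
          _ , xby = successor-transport x₀pz₀ xpz x₀by₀
      in cong (ℕ._* suc m) (≡.sym (count-successors b xby))
    -- Outside `b` both terms vanish; inside `b`, `regular` replaces the chosen pair that defines
    -- `∇` by `(x , y)`.
    on-b : ∀ y → 𝟙 (rel b x y) ℕ.* ∇ p q b ≡ 𝟙 (rel b x y) ℕ.* paths p q x y
    on-b y with rel b x y in eq
    ... | false = refl
    ... | true  = let _ , _ , x₀by₀ = nonempty b in
      cong (1 ℕ.*_) (regular p q b x₀by₀ (subst T (≡.sym eq) _))

  -- Double counting of the `p`, `q` paths that start at `x`, first by the relation of their
  -- endpoints, then by their midpoint. The step `x ⟨ p ⟩ z` makes the number of midpoints equal to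
  -- the valency of `p`; the step `z ⟨ q ⟩ y` lets every midpoint have `q`-successors.
  ∑-valency*∇ : ∀ {p q x z y} → x ⟨ p ⟩ z → z ⟨ q ⟩ y →
    ∑ℕ S (λ b → valency b ℕ.* ∇ p q b) ≡ valency p ℕ.* valency q
  ∑-valency*∇ {p} {q} {x} {z₀} xpz₀ z₀qy₀ = begin
    ∑ℕ S (λ b → valency b ℕ.* ∇ p q b)
      ≡⟨ ∑ℕ-cong S (valency*∇ xpz₀) ⟩
    ∑ℕ S (λ b → ∑ℕ X (λ y → 𝟙 (rel b x y) ℕ.* paths p q x y))
      ≡⟨ ℕΣ.∑-comm {card S} {card X} _ ⟩
    ∑ℕ X (λ y → ∑ℕ S (λ b → 𝟙 (rel b x y) ℕ.* paths p q x y))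
      ≡⟨ ∑ℕ-cong X (λ y → ≡.sym (ℕΣ.*-distribʳ-sum (paths p q x y)
                                            λ i → 𝟙 (rel (element S i) x y))) ⟩
    ∑ℕ X (λ y → ∑ℕ S (λ b → 𝟙 (rel b x y)) ℕ.* paths p q x y)
      ≡⟨ ∑ℕ-cong X (λ y → ≡.trans (cong (ℕ._* paths p q x y) (∑-rel x y)) (ℕ.*-identityˡ _)) ⟩
    ∑ℕ X (λ y → paths p q x y)
      ≡⟨ ∑ℕ-cong X (λ y → ≡.trans (count≡∑ X λ z → rel p x z ∧ rel q z y)
                                     (∑ℕ-cong X λ z → 𝟙-∧ (rel p x z) (rel q z y))) ⟩
    ∑ℕ X (λ y → ∑ℕ X (λ z → 𝟙 (rel p x z) ℕ.* 𝟙 (rel q z y)))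
      ≡⟨ ℕΣ.∑-comm {card X} {card X} _ ⟩
    ∑ℕ X (λ z → ∑ℕ X (λ y → 𝟙 (rel p x z) ℕ.* 𝟙 (rel q z y)))
      ≡⟨ ∑ℕ-cong X from-z ⟩
    ∑ℕ X (λ z → 𝟙 (rel p x z) ℕ.* valency q)
      ≡⟨ ℕΣ.*-distribʳ-sum (valency q) (λ i → 𝟙 (rel p x (element X i))) ⟨
    ∑ℕ X (λ z → 𝟙 (rel p x z)) ℕ.* valency q
      ≡⟨ cong (ℕ._* valency q) (≡.trans (≡.sym (count≡∑ X (rel p x))) (count-successors p xpz₀)) ⟩
    valency p ℕ.* valency q ∎
    where
    open ≡.≡-Reasoning
    from-z : ∀ z → ∑ℕ X (λ y → 𝟙 (rel p x z) ℕ.* 𝟙 (rel q z y)) ≡ 𝟙 (rel p x z) ℕ.* valency q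
    from-z z = ≡.trans (≡.sym (ℕΣ.*-distribˡ-sum (𝟙 (rel p x z)) λ i → 𝟙 (rel q z (element X i)))) step
      where
      step : 𝟙 (rel p x z) ℕ.* ∑ℕ X (λ y → 𝟙 (rel q z y)) ≡ 𝟙 (rel p x z) ℕ.* valency q
      step with rel p x z in eq
      ... | false = refl
      ... | true  =
        -- Both `z₀` and `z` have `x` as a successor under the converse of `p`, so the `q`-successor
        -- `y₀` of `z₀` transports to one of `z`.
        let _ , conv = converse p
            _ , zqy = successor-transport (Equivalence.from (conv z₀ x) xpz₀)
                        (Equivalence.from (conv z x) (subst T (≡.sym eq) _)) z₀qy₀
        in cong (1 ℕ.*_) (≡.trans (≡.sym (count≡∑ X (rel q z))) (count-successors q zqy))

  -- The factor `∇ p q a` removes the composability hypothesis: if it is zero both sides vanish, and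
  -- otherwise it yields a `p`, `q` path.
  ∇*∑-valency*∇ : ∀ p q a →
    ∇ p q a ℕ.* ∑ℕ S (λ b → valency b ℕ.* ∇ p q b) ≡ ∇ p q a ℕ.* (valency p ℕ.* valency q)
  ∇*∑-valency*∇ p q a with ∇ p q a in eq
  ... | zero  = refl
  ... | suc m = let _ , xpz , zqy = paths-witness eq in cong (suc m ℕ.*_) (∑-valency*∇ xpz zqy)

-- The eigenvector equation

module _ {X : FinSet} (C : CoherentConfiguration X) where
  open CoherentConfiguration C

  -- The rearrangement confines `b` to the natural number `valency b * ∇ p q b`, so the sum over `b`
  -- can be evaluated in ℕ.
  mult-product : ∀ p q a b →
    let instance _ = ℕ.m*n≢0 (valency p) (valency q) {{valency-nonZero p}} {{valency-nonZero q}}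
    in √ (fromℕ (valency b)) * (mult-entry C p q b * mult-entry C p q a)
       ≋ √ (fromℕ (valency a)) * (fromℕ (∇ p q a) * ratio 1 (valency p ℕ.* valency q))
         * fromℕ (valency b ℕ.* ∇ p q b)
  mult-product p q a b = begin
    kb * ((sb * Nb) * (sa * Na))
      ≈⟨ solve 5 (λ k s M t N → (k ⊕ ((s ⊕ M) ⊕ (t ⊕ N))) ⊜ ((k ⊕ (s ⊕ t)) ⊕ (M ⊕ N)))
           ≋-refl kb sb Nb sa Na ⟩
    (kb * (sb * sa)) * (Nb * Na)
      ≈⟨ ≋-congʳ (√-ratio (valency b) (valency a) d) ⟩
    (ka * (Kb * u)) * (Nb * Na)
      ≈⟨ solve 5 (λ k K u M N → ((k ⊕ (K ⊕ u)) ⊕ (M ⊕ N)) ⊜ ((k ⊕ (N ⊕ u)) ⊕ (K ⊕ M)))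
           ≋-refl ka Kb u Nb Na ⟩
    (ka * (Na * u)) * (Kb * Nb)
      ≈⟨ *-congˡ (fromℕ-* (valency b) (∇ p q b)) ⟨
    (ka * (Na * u)) * fromℕ (valency b ℕ.* ∇ p q b) ∎
    where
    open ≋-Reasoning
    d = valency p ℕ.* valency q
    instance
      d≢0 : NonZero d
      d≢0 = ℕ.m*n≢0 (valency p) (valency q) {{valency-nonZero p}} {{valency-nonZero q}}
    ka = √ (fromℕ (valency a))
    kb = √ (fromℕ (valency b))
    Kb = fromℕ (valency b)
    Na = fromℕ (∇ p q a)
    Nb = fromℕ (∇ p q b)
    sa = √ (ratio (valency a) d)
    sb = √ (ratio (valency b) d)
    u = ratio 1 d

  ∑-mult-product : ∀ p q a →
    ∑ S (λ b → √ (fromℕ (valency b)) * (mult-entry C p q b * mult-entry C p q a))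
    ≋ √ (fromℕ (valency a)) * fromℕ (∇ p q a)
  ∑-mult-product p q a = begin
    ∑ S (λ b → √ (fromℕ (valency b)) * (mult-entry C p q b * mult-entry C p q a))
      ≈⟨ ∑-cong S (mult-product p q a) ⟩
    ∑ S (λ b → (ka * (Na * u)) * fromℕ (valency b ℕ.* ∇ p q b))
      ≈⟨ *-distribˡ-∑ S (ka * (Na * u)) (λ b → fromℕ (valency b ℕ.* ∇ p q b)) ⟨
    (ka * (Na * u)) * ∑ S (λ b → fromℕ (valency b ℕ.* ∇ p q b))
      ≈⟨ *-congˡ (fromℕ-∑ S (λ b → valency b ℕ.* ∇ p q b)) ⟨
    (ka * (Na * u)) * fromℕ s
      -- `Na` is moved next to the sum because replacing `s` by `d` is valid for all `p`, `q` only
      -- in the presence of the factor `∇ p q a`.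
      ≈⟨ solve 4 (λ k N u s → ((k ⊕ (N ⊕ u)) ⊕ s) ⊜ ((k ⊕ u) ⊕ (N ⊕ s))) ≋-refl ka Na u (fromℕ s) ⟩
    (ka * u) * (Na * fromℕ s)
      ≈⟨ *-congˡ (fromℕ-* (∇ p q a) s) ⟨
    (ka * u) * fromℕ (∇ p q a ℕ.* s)
      ≡⟨ cong (λ m → (ka * u) * fromℕ m) (∇*∑-valency*∇ C p q a) ⟩
    (ka * u) * fromℕ (∇ p q a ℕ.* d)
      ≈⟨ *-congˡ (fromℕ-* (∇ p q a) d) ⟩
    (ka * u) * (Na * fromℕ d)
      ≈⟨ solve 4 (λ k N u s → ((k ⊕ u) ⊕ (N ⊕ s)) ⊜ ((k ⊕ N) ⊕ (s ⊕ u))) ≋-refl ka Na u (fromℕ d) ⟩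
    (ka * Na) * (fromℕ d * u)
      ≈⟨ *-congˡ (ratio-inverse d) ⟩
    (ka * Na) * fromℕ 1
      ≈⟨ *-identityʳ (ka * Na) ⟩
    ka * Na ∎
    where
    open ≋-Reasoning
    d = valency p ℕ.* valency q
    s = ∑ℕ S (λ b → valency b ℕ.* ∇ p q b)
    instance
      d≢0 : NonZero d
      d≢0 = ℕ.m*n≢0 (valency p) (valency q) {{valency-nonZero p}} {{valency-nonZero q}}
    ka = √ (fromℕ (valency a))
    Na = fromℕ (∇ p q a)
    u = ratio 1 d

  -- The left side is the unfolded entry at `a` of `(mult ∘ mult †) ∘ v`. Exchanging the sums puts
  -- `b` innermost, so `∑-mult-product` applies for fixed `p`, `q`.
  valencyVector-eigen : ∀ a →
    ∑ S (λ b → √ (fromℕ (valency b)) *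
      ∑ (S ⊗ S) (λ (p , q) → mult-entry C p q b * mult-entry C p q a))
    ≋ fromℕ (card X) * √ (fromℕ (valency a))
  valencyVector-eigen a = begin
    ∑ S (λ b → √ (fromℕ (valency b)) * ∑ (S ⊗ S) (λ pq → M pq b))
      ≈⟨ ∑-cong S (λ b → *-distribˡ-∑ (S ⊗ S) (√ (fromℕ (valency b))) (λ pq → M pq b)) ⟩
    ∑ S (λ b → ∑ (S ⊗ S) (λ pq → √ (fromℕ (valency b)) * M pq b))
      ≈⟨ ∑-comm S (S ⊗ S) (λ b pq → √ (fromℕ (valency b)) * M pq b) ⟩
    ∑ (S ⊗ S) (λ pq → ∑ S (λ b → √ (fromℕ (valency b)) * M pq b))
      ≈⟨ ∑-cong (S ⊗ S) (λ (p , q) → ∑-mult-product p q a) ⟩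
    ∑ (S ⊗ S) (λ (p , q) → ka * fromℕ (∇ p q a))
      ≈⟨ *-distribˡ-∑ (S ⊗ S) ka (λ (p , q) → fromℕ (∇ p q a)) ⟨
    ka * ∑ (S ⊗ S) (λ (p , q) → fromℕ (∇ p q a))
      ≈⟨ *-congˡ (fromℕ-∑ (S ⊗ S) (λ (p , q) → ∇ p q a)) ⟨
    ka * fromℕ (∑ℕ (S ⊗ S) (λ (p , q) → ∇ p q a))
      ≡⟨ cong (λ n → ka * fromℕ n) (∑-∇≡card C a) ⟩
    ka * fromℕ (card X)
      ≈⟨ ⌊ *-comm ka (fromℕ (card X)) ⌋ ⟩
    fromℕ (card X) * ka ∎
    where
    open ≋-Reasoning
    ka = √ (fromℕ (valency a))
    M : Carrier (S ⊗ S) → Carrier S → ℝ≥0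
    M (p , q) b = mult-entry C p q b * mult-entry C p q a

  -- Squaring a vanishing root would make the valency itself vanish, yet it is positive.
  √-valency≉0 : ∀ a → ¬ √ (fromℕ (valency a)) ≋ fromℕ 0
  √-valency≉0 a √k≋0 with valency a | valency-nonZero a
  ... | suc k | _ = fromℕ-suc≉0 k (≋-trans (≋-sym ⌊ √-square (fromℕ (suc k)) ⌋)
    (≋-trans (*-cong √k≋0 √k≋0) (zeroˡ (fromℕ 0))))

lemma8p1 : (X : FinSet) (C : CoherentConfiguration X) →
    let open FrobeniusData (frobenius C) using (mult)
        M = mult ∘ mult †
        v = valencyVector C
        n = fromℕ (card X)
    in (M ∘ v ≐ n • v) × (Carrier X → IsEigenvector M v n)
lemma8p1 X C = eigen , λ x → nonzero x , eigen
  where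
  eigen = λ _ a → ⌈ valencyVector-eigen C a ⌉
  -- A point `x` provides a block, that of `(x , x)`, at which `v` does not vanish. For empty `X`
  -- there are no blocks and `v` is the zero vector.
  nonzero : Carrier X → ¬ (valencyVector C ≐ zeroMatrix)
  nonzero x v≐0 =
    let a , _ = CoherentConfiguration.cover C x x
    in √-valency≉0 C a ⌊ v≐0 tt a ⌋
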